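{- Let $\lambda$ be a partition and let $M,M'\in\mathrm{MLQ}_\lambda$ lie in the same connected component of the crystal graph on $\mathrm{MLQ}_\lambda$ (equivalently, $\rho_Q(M)=\rho_Q(M')$). Then \[ \mathrm{type}(\rho_N(M))=\mathrm{type}(\rho_N(M'))\implies \mathrm{type}(M)=\mathrm{type}(M'). \]
   Context: Fix $n$. For a partition $\lambda$ with $L=\lambda_1$, $n>\ell(\lambda)$, a multiline queue (MLQ) of shape $\lambda$ is a tuple $M=(B_1,\dots,B_L)$ of subsets of $[n]$ with $|B_r|=\lambda'_r$ ($\lambda'$ the conjugate partition), pictured as an $L\times n$ array with rows $1..L$ bottom to top and columns $1..n$ left to right, cyclically; a ball at $(r,j)$ iff $j\in B_r$. $\mathrm{MLQ}_\lambda$ is the set of these. FM labelling: for $r=L,\dots,2$: unlabelled balls of row $r$ get label $r$; then balls of row $r$ in order of decreasing label (left to right among equal labels) are each paired with the first not-yet-paired ball of row $r-1$ weakly to its right (cyclically wrapping from column $n$ to column 1), which gets the same label. Remaining unlabelled balls of row 1 get label 1. $\mathrm{type}(M)$ is the length-$n$ sequence of labels in row 1 (0 at empty sites). Bracketing: for a word $w$ and $i\ge1$, replace each $i$ by ")" and each $i+1$ by "(" (ignore other letters) and iteratively match a "(" with a ")" to its right when no unmatched parenthesis lies between them; other $i$'s, $(i+1)$'s are unmatched. Column operators: the row word $rw(M)$ lists column indices of balls reading rows top to bottom, each row right to left. For $1\le i<n$, $e^{\leftarrow}_i(M)$ moves the ball corresponding to the leftmost unmatched $i+1$ of $rw(M)$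 from column $i+1$ to column $i$ (same row), and $f^{\rightarrow}_i(M)$ moves the ball of the rightmost unmatched $i$ from column $i$ to column $i+1$; identity if none exists. The crystal graph has vertex set $\mathrm{MLQ}_\lambda$ and an edge $M\to f^{\rightarrow}_i(M)$ for each $i$; connected components are taken ignoring edge directions. Collapsing: for a tuple $N$ of subsets of $[n]$, $cw(N)$ lists row indices of balls, columns left to right, each column top to bottom. $e^{\downarrow}_j(N)$ moves the ball of the leftmost unmatched $j+1$ in $cw(N)$ (bracketing w.r.t. $j$) from row $j+1$ to row $j$ in the same column (identity if none); $e^{\downarrow\star}_j$ iterates $e^{\downarrow}_j$ until it acts trivially. For $M=(B_1,\dots,B_L)$: $M_1=M$, $Q_1$ one row of $|B_1|$ boxes filled with 1; for $i=1,\dots,L-1$, $M_{i+1}=e^{\downarrow\star}_1\cdots e^{\downarrow\star}_i(M_i)$ (rightmost first) and $Q_{i+1}$ is $Q_i$ with $|B^{(i+1)}_j|-|B^{(i)}_j|$ boxes added to row $j$ ($j\le i$) and $|B^{(i+1)}_{i+1}|$ boxes forming row $i+1$, all filled with $i+1$, where $M_i=(B^{(i)}_1,\dots,B^{(i)}_L)$. $\rho_N(M)=M_L$ (a nonwrapping MLQ) and $\rho_Q(M)=Q_L$ (a semistandard tableau, French convention). -}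

module Defs where

open import Data.Nat using (ℕ; zero; suc; _∸_; _≤_; _<_; _≥_; _≡ᵇ_; _≤ᵇ_)
open import Data.Bool using (Bool; true; false; if_then_else_; _∧_)
open import Data.List using (List; []; _∷_; _++_; map; concatMap; reverse; length; upTo; drop; take; replicate; zip; foldl; last; head)
open import Data.List.Relation.Unary.All using (All)
open import Data.List.Relation.Unary.Linked using (Linked)
open import Data.Maybe using (Maybe; just; nothing)
open import Data.Product using (_×_; _,_; proj₁; proj₂; Σ)
open import Data.Vec using (Vec; []; _∷_)
open import Data.Fin.Subset using (Subset; ∣_∣)
open import Relation.Binary.PropositionalEquality using (_≡_)
open import Relation.Binary.Construct.Closure.Equivalence using (EqClosure)

IsPartition : List ℕ → Set
IsPartition λ′ = Linked _≥_ λ′ × All (1 ≤_) λ′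

firstPart : List ℕ → ℕ
firstPart []      = 0
firstPart (x ∷ _) = x

keep : {A : Set} → (A → Bool) → List A → List A
keep p []       = []
keep p (x ∷ xs) = if p x then x ∷ keep p xs else keep p xs

conjugate : List ℕ → List ℕ
conjugate λ′ = map (λ r → length (keep (λ p → suc r ≤ᵇ p) λ′)) (upTo (firstPart λ′))

-- Configurations: a tuple (B_1, …, B_L) of subsets of [n], listed
-- bottom row first.  Column j ∈ [n] is the Fin index j-1; row r is
-- list position r-1.

Config : ℕ → Set
Config n = List (Subset n)

IsMLQ : (n : ℕ) → List ℕ → Config n → Set
IsMLQ n λ′ M = map ∣_∣ M ≡ conjugate λ′

-- ℕ-indexed helpers (0-based, out of range: default / no-op)

getV : ∀ {n} → Vec Bool n → ℕ → Bool
getV []      _       = false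
getV (b ∷ v) zero    = b
getV (b ∷ v) (suc k) = getV v k

setV : ∀ {n} → Vec Bool n → ℕ → Bool → Vec Bool n
setV []      _       _ = []
setV (b ∷ v) zero    x = x ∷ v
setV (b ∷ v) (suc k) x = b ∷ setV v k x

get : List ℕ → ℕ → ℕ
get []       _       = 0
get (x ∷ xs) zero    = x
get (x ∷ xs) (suc k) = get xs k

setL : List ℕ → ℕ → ℕ → List ℕ
setL []       _       _ = []
setL (x ∷ xs) zero    y = y ∷ xs
setL (x ∷ xs) (suc k) y = x ∷ setL xs k y

updRow : ∀ {n} → Config n → ℕ → (Subset n → Subset n) → Config n
updRow []       _       f = []
updRow (r ∷ rs) zero    f = f r ∷ rs
updRow (r ∷ rs) (suc k) f = r ∷ updRow rs k f

findFirst : (ℕ → Bool) → List ℕ → Maybe ℕ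
findFirst p []       = nothing
findFirst p (x ∷ xs) = if p x then just x else findFirst p xs

indexed : {A : Set} → List A → List (ℕ × A)
indexed xs = zip (upTo (length xs)) xs

labelsDesc : ℕ → List ℕ
labelsDesc zero    = []
labelsDesc (suc k) = suc k ∷ labelsDesc k

-- FM labelling and type.
-- A labelled row is a list of n labels (0 = no ball).
-- fmStep L d above row : given the labels of row r (above), the balls of
-- row r-1, and the default label d = r-1, pair the balls of row r in
-- order of decreasing label (left to right among equal labels) with the
-- first unpaired ball of row r-1 weakly to the right, cyclically; the
-- unpaired balls of row r-1 get label d.

fmStep : ∀ {n} → ℕ → ℕ → List ℕ → Subset n → List ℕ
fmStep {n} L d above row =
  map (λ k → if getV row k then (if get asg k ≡ᵇ 0 then d else get asg k) else 0) us
  where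
  us : List ℕ
  us = upTo n
  order : List ℕ
  order = concatMap (λ ℓ → keep (λ j → get above j ≡ᵇ ℓ) us) (labelsDesc L)
  pairOne : List ℕ → ℕ → List ℕ
  pairOne a j with findFirst (λ k → getV row k ∧ (get a k ≡ᵇ 0)) (drop j us ++ take j us)
  ... | nothing = a
  ... | just k  = setL a k (get above j)
  asg : List ℕ
  asg = foldl pairOne (replicate n 0) order

fmGo : ∀ {n} → ℕ → ℕ → List ℕ → List (Subset n) → List ℕ
fmGo L d lab []           = lab
fmGo L d lab (row ∷ rest) = fmGo L (d ∸ 1) (fmStep L d lab row) rest

typeOf : ∀ {n} → Config n → List ℕ
typeOf {n} M = fmGo (length M) (length M) (replicate n 0) (reverse M)

-- Bracketing.  For a word of tagged letters and i ≥ 1, letter i is ")"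
-- and letter i+1 is "(".  Returns (unmatched i's, unmatched (i+1)'s),
-- each in left-to-right order.

unmatched : {T : Set} → ℕ → List (T × ℕ) → List T × List T
unmatched {T} i = go [] []
  where
  go : List T → List T → List (T × ℕ) → List T × List T
  go st cl []            = reverse cl , reverse st
  go st cl ((t , a) ∷ w) with a ≡ᵇ i | a ≡ᵇ suc i
  go []        cl ((t , a) ∷ w) | true  | _     = go [] (t ∷ cl) w
  go (_ ∷ st)  cl ((t , a) ∷ w) | true  | _     = go st cl w
  go st        cl ((t , a) ∷ w) | false | true  = go (t ∷ st) cl w
  go st        cl ((t , a) ∷ w) | false | false = go st cl w

-- Column crystal operators.
-- Balls are tagged by (row index 0-based, column index 0-based).

rw : ∀ {n} → Config n → List ((ℕ × ℕ) × ℕ)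
rw {n} M =
  concatMap (λ (rrow : ℕ × Subset n) →
              map (λ c → ((proj₁ rrow , c) , suc c))
                  (keep (getV (proj₂ rrow)) (reverse (upTo n))))
            (reverse (indexed M))

fOp : ∀ {n} → ℕ → Config n → Config n
fOp i M with last (proj₁ (unmatched i (rw M)))
... | nothing       = M
... | just (r , c)  = updRow M r (λ row → setV (setV row c false) (suc c) true)

Edge : (n : ℕ) → List ℕ → Config n → Config n → Set
Edge n λ′ M N = IsMLQ n λ′ M × IsMLQ n λ′ N × Σ ℕ (λ i → 1 ≤ i × i < n × N ≡ fOp i M)

SameComponent : (n : ℕ) → List ℕ → Config n → Config n → Set
SameComponent n λ′ = EqClosure (Edge n λ′)

cw : ∀ {n} → Config n → List ((ℕ × ℕ) × ℕ)
cw {n} N =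
  concatMap (λ c → map (λ (rrow : ℕ × Subset n) → ((proj₁ rrow , c) , suc (proj₁ rrow)))
                       (keep (λ (rrow : ℕ × Subset n) → getV (proj₂ rrow) c) (reverse (indexed N))))
            (upTo n)

eDown : ∀ {n} → ℕ → Config n → Config n
eDown j N with head (proj₂ (unmatched j (cw N)))
... | nothing      = N
... | just (r , c) = updRow (updRow N r (λ row → setV row c false)) (r ∸ 1) (λ row → setV row c true)

iter : {A : Set} → ℕ → (A → A) → A → A
iter zero    f x = x
iter (suc k) f x = iter k f (f x)

-- e↓⋆_j : iterate e↓_j until it acts trivially.  Each nontrivial step
-- removes a ball from row j+1 (at most n balls) and a trivial step is the
-- identity, so n iterations reach the fixed point.
eDownStar : ∀ {n} → ℕ → Config n → Config n
eDownStar {n} j = iter n (eDown j)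

sweep : ∀ {n} → ℕ → Config n → Config n
sweep zero    N = N
sweep (suc i) N = sweep i (eDownStar (suc i) N)

rhoLoop : ∀ {n} → ℕ → ℕ → Config n → Config n
rhoLoop zero    i N = N
rhoLoop (suc k) i N = rhoLoop k (suc i) (sweep i N)

rhoN : ∀ {n} → Config n → Config n
rhoN M = rhoLoop (length M ∸ 1) 1 M

{-# OPTIONS --safe #-}

-- View a configuration as a 0/1 matrix with two commuting crystal structures, the
-- column operators f→ and the row operators e↓.  Cyclic FM pairing of two adjacent
-- rows is the row reflection s, so the balls of row 1 with label at least k form the
-- bottom row of s₁ ⋯ sₖ₋₁ M; these bottom rows are the keys of M and determine its
-- type.  Reflections do not leave the row component, and a row component has only
-- one highest element: after moving to a column-lowest position, a row-highest
-- element is right-justified and hence determined by its column sums.  So all the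
-- reflected configurations collapse to ρ_N(M).  Finally, the bottom row of any
-- configuration is an explicit function of the keys of its collapse and of the row
-- sizes met on the way, and these sizes are constant on components of the crystal
-- graph because f→ commutes with e↓ and s.

module Submission where

open import Defs
open import Data.Nat using (ℕ; zero; suc; pred; _+_; _∸_; _⊓_; _≤_; _<_; z≤n; s≤s; s≤s⁻¹; s<s; _≤?_; _≤ᵇ_; _<ᵇ_; _≡ᵇ_)
open import Data.Nat.Properties
open import Data.Bool using (Bool; true; false; if_then_else_; _∧_; _∨_; not; T)
open import Data.Bool.Properties using (∨-assoc; ∨-identityʳ; ∨-zeroʳ; ∧-zeroʳ)
open import Data.List using (List; []; _∷_; _∷ʳ_; _++_; map; concatMap; reverse; length; upTo; applyUpTo; downFrom; drop; take; replicate; zip; foldl; last; head)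
open import Data.List.Properties using (∷-injective; ∷-injectiveˡ; ∷-injectiveʳ; unfold-reverse; reverse-involutive; reverse-upTo; length-reverse; concatMap-++; foldl-++; ++-identityʳ; map-++; map-applyUpTo; length-map; length-replicate; length-upTo; take++drop≡id)
open import Data.List.Relation.Unary.All as All using (All; []; _∷_)
import Data.List.Relation.Unary.All.Properties as All
open import Data.List.Relation.Unary.AllPairs using (AllPairs; []; _∷_)
import Data.List.Relation.Unary.Unique.Propositional.Properties as Unique
open import Data.Maybe as Maybe using (Maybe; just; nothing; _<∣>_)
import Data.Maybe.Properties as Maybe
open import Data.Product using (_×_; _,_; proj₁; proj₂; ∃)
open import Data.Sum using (_⊎_; inj₁; inj₂; [_,_]′)
open import Data.Unit using (⊤; tt)
open import Data.Vec using ([]; _∷_)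
import Data.Vec.Properties as Vec
open import Data.Fin.Subset using (Subset; ∣_∣) renaming (⊥ to ∅)
open import Data.Fin.Subset.Properties using (∣p∣≤n)
open import Function using (_∋_; _∘_; id; it)
open import Relation.Nullary using (yes; no; contradiction)
open import Relation.Binary.Construct.Closure.Equivalence using (gfold)
open import Relation.Binary.PropositionalEquality

-- The obstacle is that the rows of the collapsed configuration above its bottom row cannot be read
-- from its keys: a key shows such a row only after it has been parked in the rows below. Rebuilding
-- succeeds because adding the leftmost untaken places commutes with parking. If U is contained in S
-- and nothing wraps, the m leftmost elements of S outside U may be added to U before or after both
-- sets are parked in a further row. The lower row B of a pair is exactly of this form: the places
-- of `low A B` taken by `up A B`, and the `closes A B` leftmost other places. The number
-- `closes A B` is the difference of the sizes of B and `up A B`, so sizes and keys suffice.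
--
-- FM pairs balls one at a time, in an order set by labels, while the bracketing scan treats a whole
-- row at once. They agree because the set of occupied places does not depend on the order in which
-- the cars park; the number of wrapping cars is a fixed point of one turn around the cycle.

variable
  n : ℕ

-- Bracketing of two adjacent rows

-- Two adjacent rows, A above B, are a word of sites read left to right, with a
-- ball of A an opening and a ball of B a closing bracket; a site with both is
-- matched in itself.  The recursions run from the right end, where closes and
-- opens count the unmatched brackets, and (up , low) is e↓⋆ of the two rows.

closeSite : Bool → Bool → ℕ → ℕ
closeSite true  false u = pred u
closeSite false true  u = suc u
closeSite true  true  u = u
closeSite false false u = u

openSite : Bool → Bool → ℕ → ℕ → ℕ
openSite true  false zero    o = suc o
openSite true  false (suc _) o = o
openSite true  true  _       o = o
openSite false _     _       o = o

upSite : Bool → Bool → ℕ → Bool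
upSite true  false zero    = false
upSite true  false (suc _) = true
upSite true  true  _       = true
upSite false _     _       = false

lowSite : Bool → Bool → ℕ → Bool
lowSite true  false zero    = true
lowSite true  false (suc _) = false
lowSite true  true  _       = true
lowSite false b     _       = b

closes : Subset n → Subset n → ℕ
closes []      []      = 0
closes (a ∷ A) (b ∷ B) = closeSite a b (closes A B)

opens : Subset n → Subset n → ℕ
opens []      []      = 0
opens (a ∷ A) (b ∷ B) = openSite a b (closes A B) (opens A B)

up : Subset n → Subset n → Subset n
up []      []      = []
up (a ∷ A) (b ∷ B) = upSite a b (closes A B) ∷ up A B

low : Subset n → Subset n → Subset n
low []      []      = []
low (a ∷ A) (b ∷ B) = lowSite a b (closes A B) ∷ low A B

eligible : Bool → Bool → ℕ → Bool
eligible true  false zero    = true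
eligible true  false (suc _) = false
eligible true  true  _       = false
eligible false _     _       = false

countSite : Bool → Bool → ℕ → ℕ → ℕ
countSite q p c x = if eligible q p c then suc x else x

-- The column operators on a stack of rows

-- Columns k and k + 1 are read from the top row down.  Configurations list the
-- bottom row first, so the tail comes first in the word and the state to carry is
-- the number of unmatched opening brackets (balls in column k + 1).  A closing
-- bracket meeting none of them is eligible, and f→ moves the last eligible ball.

openCount : ℕ → Config n → ℕ
openCount k []      = 0
openCount k (r ∷ M) = closeSite (getV r k) (getV r (suc k)) (openCount k M)

closeCount : ℕ → Config n → ℕ
closeCount k []      = 0
closeCount k (r ∷ M) = countSite (getV r k) (getV r (suc k)) (openCount k M) (closeCount k M)

-- A conditional move that exposes its result before the condition is known.
moveIf : Bool → ℕ → Subset n → Subset n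
moveIf x zero    (a₀ ∷ a₁ ∷ A) = (if x then false else a₀) ∷ (if x then true else a₁) ∷ A
moveIf x zero    A             = A
moveIf x (suc k) []            = []
moveIf x (suc k) (a ∷ A)       = a ∷ moveIf x k A

eligibleAt : ℕ → Subset n → Config n → Bool
eligibleAt k r M = eligible (getV r k) (getV r (suc k)) (openCount k M)

moveRight : ℕ → Config n → Config n
moveRight k []      = []
moveRight k (r ∷ M) = moveIf (eligibleAt k r M) k r ∷ (if eligibleAt k r M then M else moveRight k M)

lowerAll : ℕ → Config n → Config n
lowerAll _       []          = []
lowerAll zero    (B ∷ [])    = B ∷ []
lowerAll zero    (B ∷ A ∷ M) = low A B ∷ up A B ∷ M
lowerAll (suc j) (r ∷ M)     = r ∷ lowerAll j M

-- Commutation of f→ with e↓⋆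

data Act : Set where
  lower upper none : Act

-- The lower row is read after the upper one, so its eligible ball takes precedence.
act : Bool → Bool → Bool → Bool → ℕ → Act
act a₀ a₁ b₀ b₁ c =
  if eligible b₀ b₁ (closeSite a₀ a₁ c) then lower else if eligible a₀ a₁ c then upper else none

actAt : ℕ → ℕ → Subset n → Subset n → Act
actAt k c A B = act (getV A k) (getV A (suc k)) (getV B k) (getV B (suc k)) c

isUpper isLower isNone : Act → Bool
isUpper upper = true
isUpper lower = false
isUpper none  = false
isLower lower = true
isLower upper = false
isLower none  = false
isNone lower = false
isNone upper = false
isNone none  = true

-- The sixteen cases are instance arguments: once the Booleans are constructors both sides of
-- `MovesCommute` compute, and `reflexive` fills each case.
cases⁴ : {P : Bool → Bool → Bool → Bool → Set}
  ⦃ _ : P true true true true ⦄ ⦃ _ : P true true true false ⦄ ⦃ _ : P true true false true ⦄ ⦃ _ : P true true false false ⦄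
  ⦃ _ : P true false true true ⦄ ⦃ _ : P true false true false ⦄ ⦃ _ : P true false false true ⦄ ⦃ _ : P true false false false ⦄
  ⦃ _ : P false true true true ⦄ ⦃ _ : P false true true false ⦄ ⦃ _ : P false true false true ⦄ ⦃ _ : P false true false false ⦄
  ⦃ _ : P false false true true ⦄ ⦃ _ : P false false true false ⦄ ⦃ _ : P false false false true ⦄ ⦃ _ : P false false false false ⦄
  → ∀ a b c d → P a b c d
cases⁴ true  true  true  true  = it
cases⁴ true  true  true  false = it
cases⁴ true  true  false true  = it
cases⁴ true  true  false false = it
cases⁴ true  false true  true  = it
cases⁴ true  false true  false = it
cases⁴ true  false false true  = it
cases⁴ true  false false false = it
cases⁴ false true  true  true  = it
cases⁴ false true  true  false = it
cases⁴ false true  false true  = it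
cases⁴ false true  false false = it
cases⁴ false false true  true  = it
cases⁴ false false true  false = it
cases⁴ false false false true  = it
cases⁴ false false false false = it

-- The row word of the two rows sees f→ₖ, and the column word sees e↓⋆, only through
-- the 2 × 2 block in columns k and k + 1, the number c of open brackets coming from
-- the rows above and the number of closing brackets coming from the columns to the
-- right; of these numbers only the cases 0, 1 and ≥ 2 differ.  The ball moved by
-- f→ₖ may lie in different rows before and after e↓⋆, hence the two actions d and d′.
MovesCommute : ℕ → ℕ → ℕ → Subset n → Subset n → Set
MovesCommute k c x A B =
  (closes A′ B′ , opens A′ B′ , up A′ B′ , low A′ B′ , isNone d′
    , closeSite (getV (low A B) k) (getV (low A B) (suc k)) (closeSite (getV (up A B) k) (getV (up A B) (suc k)) c)
    , countSite (getV (low A B) k) (getV (low A B) (suc k)) (closeSite (getV (up A B) k) (getV (up A B) (suc k)) c)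
         (countSite (getV (up A B) k) (getV (up A B) (suc k)) c x))
  ≡ (closes A B , opens A B , moveIf (isUpper d′) k (up A B) , moveIf (isLower d′) k (low A B) , isNone d
    , closeSite (getV B k) (getV B (suc k)) (closeSite (getV A k) (getV A (suc k)) c)
    , countSite (getV B k) (getV B (suc k)) (closeSite (getV A k) (getV A (suc k)) c)
         (countSite (getV A k) (getV A (suc k)) c x))
  where
  d = actAt k c A B
  d′ = actAt k c (up A B) (low A B)
  A′ = moveIf (isUpper d) k A
  B′ = moveIf (isLower d) k B

instance
  reflexive : {S : Set} {x : S} → x ≡ x
  reflexive = refl

block : ∀ c x (A B : Subset n) a₀ a₁ b₀ b₁ → MovesCommute 0 c x (a₀ ∷ a₁ ∷ A) (b₀ ∷ b₁ ∷ B)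
block zero          x A B with closes A B
... | zero        = cases⁴
... | suc zero    = cases⁴
... | suc (suc _) = cases⁴
block (suc zero)    x A B with closes A B
... | zero        = cases⁴
... | suc zero    = cases⁴
... | suc (suc _) = cases⁴
block (suc (suc _)) x A B with closes A B
... | zero        = cases⁴
... | suc zero    = cases⁴
... | suc (suc _) = cases⁴

move-pair : ∀ k c x (A B : Subset n) → suc k < n → MovesCommute k c x A B
move-pair zero    c x (a₀ ∷ a₁ ∷ A) (b₀ ∷ b₁ ∷ B) _ = block c x A B a₀ a₁ b₀ b₁
move-pair zero    c x (_ ∷ []) (_ ∷ []) (s≤s ())
move-pair (suc k) c x (a ∷ A) (b ∷ B) (s≤s k<n) with move-pair k c x A B k<n
-- A column to the left of k meets the rest only through `closes` and `opens`, which the move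
-- preserves. Abstracting both actions turns the components of `e` into rewrite rules for arbitrary
-- `d` and `d′`.
... | e with actAt k c A B | actAt k c (up A B) (low A B)
  | cong proj₁ e | cong (λ t → proj₁ (proj₂ t)) e | cong (λ t → proj₁ (proj₂ (proj₂ t))) e
  | cong (λ t → proj₁ (proj₂ (proj₂ (proj₂ t)))) e | cong (λ t → proj₂ (proj₂ (proj₂ (proj₂ t)))) e
... | d | d′ | e₁ | e₂ | e₃ | e₄ | e₅ rewrite e₁ | e₂ | e₃ | e₄ | e₅ = refl

module MovePair {n : ℕ} (k c x : ℕ) (A B : Subset n) (k<n : suc k < n) where
  private
    equations = move-pair k c x A B k<n
  same-closes     = cong proj₁ equations
  same-opens      = cong (λ t → proj₁ (proj₂ t)) equations
  up-move         = cong (λ t → proj₁ (proj₂ (proj₂ t))) equations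
  low-move        = cong (λ t → proj₁ (proj₂ (proj₂ (proj₂ t)))) equations
  same-none       = cong (λ t → proj₁ (proj₂ (proj₂ (proj₂ (proj₂ t))))) equations
  same-openCount  = cong (λ t → proj₁ (proj₂ (proj₂ (proj₂ (proj₂ (proj₂ t)))))) equations
  same-closeCount = cong (λ t → proj₂ (proj₂ (proj₂ (proj₂ (proj₂ (proj₂ t)))))) equations

moveIf-false : ∀ k (A : Subset n) → moveIf false k A ≡ A
moveIf-false zero    []           = refl
moveIf-false zero    (_ ∷ [])     = refl
moveIf-false zero    (_ ∷ _ ∷ _)  = refl
moveIf-false (suc k) []           = refl
moveIf-false (suc k) (a ∷ A)      = cong (a ∷_) (moveIf-false k A)

moveRight-two : ∀ k (B A : Subset n) M →
  let d = actAt k (openCount k M) A B in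
  moveRight k (B ∷ A ∷ M) ≡ moveIf (isLower d) k B ∷ moveIf (isUpper d) k A ∷ (if isNone d then moveRight k M else M)
moveRight-two k B A M with eligible (getV B k) (getV B (suc k)) (openCount k (A ∷ M)) | eligible (getV A k) (getV A (suc k)) (openCount k M)
... | true  | _     = cong (moveIf true k B ∷_) (cong (_∷ M) (sym (moveIf-false k A)))
... | false | true  = refl
... | false | false = refl

openCount-lowerAll : ∀ k → suc k < n → ∀ j (M : Config n) → openCount k (lowerAll j M) ≡ openCount k M
openCount-lowerAll k k<n zero    []          = refl
openCount-lowerAll k k<n (suc j) []          = refl
openCount-lowerAll k k<n zero    (B ∷ [])    = refl
openCount-lowerAll k k<n zero    (B ∷ A ∷ M) = MovePair.same-openCount k (openCount k M) 0 A B k<n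
openCount-lowerAll k k<n (suc j) (r ∷ M)     = cong (closeSite (getV r k) (getV r (suc k))) (openCount-lowerAll k k<n j M)

closeCount-lowerAll : ∀ k → suc k < n → ∀ j (M : Config n) → closeCount k (lowerAll j M) ≡ closeCount k M
closeCount-lowerAll k k<n zero    []          = refl
closeCount-lowerAll k k<n (suc j) []          = refl
closeCount-lowerAll k k<n zero    (B ∷ [])    = refl
closeCount-lowerAll k k<n zero    (B ∷ A ∷ M) = MovePair.same-closeCount k (openCount k M) (closeCount k M) A B k<n
closeCount-lowerAll k k<n (suc j) (r ∷ M)     = cong₂ (countSite (getV r k) (getV r (suc k))) (openCount-lowerAll k k<n j M) (closeCount-lowerAll k k<n j M)

-- A row below the pair meets equally many open brackets before and after e↓⋆, hence makes the same
-- choice. The search goes on above the pair in both cases or in neither, by `same-none`.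
moveRight-lowerAll : ∀ k → suc k < n → ∀ j (M : Config n) → lowerAll j (moveRight k M) ≡ moveRight k (lowerAll j M)
moveRight-lowerAll k k<n zero    []          = refl
moveRight-lowerAll k k<n (suc j) []          = refl
moveRight-lowerAll k k<n zero    (B ∷ [])    with eligibleAt k B []
... | true  = refl
... | false = refl
moveRight-lowerAll k k<n zero    (B ∷ A ∷ M)
  rewrite moveRight-two k B A M | moveRight-two k (low A B) (up A B) M
  = cong₂ _∷_ low-move (cong₂ _∷_ up-move (cong (λ x → if x then moveRight k M else M) (sym same-none)))
  where open MovePair k (openCount k M) 0 A B k<n
moveRight-lowerAll k k<n (suc j) (r ∷ M) rewrite openCount-lowerAll k k<n j M with eligibleAt k r M
... | true  = refl
... | false = cong (moveIf false k r ∷_) (moveRight-lowerAll k k<n j M)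

-- Ball counts and domination

closes+opens : ∀ (A B : Subset n) → closes A B + ∣ A ∣ ≡ ∣ B ∣ + opens A B
closes+opens []          []          = refl
closes+opens (true ∷ A)  (true ∷ B)  = trans (+-suc _ _) (cong suc (closes+opens A B))
closes+opens (false ∷ A) (true ∷ B)  = cong suc (closes+opens A B)
closes+opens (false ∷ A) (false ∷ B) = closes+opens A B
closes+opens (true ∷ A)  (false ∷ B) with closes A B | closes+opens A B
... | zero  | e = trans (cong suc e) (sym (+-suc _ _))
... | suc u | e = trans (+-suc _ _) e

∣low∣ : ∀ (A B : Subset n) → ∣ low A B ∣ ≡ ∣ B ∣ + opens A B
∣low∣ []          []          = refl
∣low∣ (true ∷ A)  (true ∷ B)  = cong suc (∣low∣ A B)
∣low∣ (false ∷ A) (true ∷ B)  = cong suc (∣low∣ A B)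
∣low∣ (false ∷ A) (false ∷ B) = ∣low∣ A B
∣low∣ (true ∷ A)  (false ∷ B) with closes A B
... | zero  = trans (cong suc (∣low∣ A B)) (sym (+-suc _ _))
... | suc u = ∣low∣ A B

∣up∣ : ∀ (A B : Subset n) → ∣ up A B ∣ + opens A B ≡ ∣ A ∣
∣up∣ []          []          = refl
∣up∣ (true ∷ A)  (true ∷ B)  = cong suc (∣up∣ A B)
∣up∣ (false ∷ A) (true ∷ B)  = ∣up∣ A B
∣up∣ (false ∷ A) (false ∷ B) = ∣up∣ A B
∣up∣ (true ∷ A)  (false ∷ B) with closes A B
... | zero  = trans (+-suc _ _) (cong suc (∣up∣ A B))
... | suc u = cong suc (∣up∣ A B)

∣up∣+closes : ∀ (A B : Subset n) → ∣ up A B ∣ + closes A B ≡ ∣ B ∣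
∣up∣+closes A B = +-cancelʳ-≡ (opens A B) _ _ (begin
  ∣ up A B ∣ + closes A B + opens A B   ≡⟨ +-assoc ∣ up A B ∣ _ _ ⟩
  ∣ up A B ∣ + (closes A B + opens A B) ≡⟨ cong (∣ up A B ∣ +_) (+-comm (closes A B) _) ⟩
  ∣ up A B ∣ + (opens A B + closes A B) ≡⟨ +-assoc ∣ up A B ∣ _ _ ⟨
  ∣ up A B ∣ + opens A B + closes A B   ≡⟨ cong (_+ closes A B) (∣up∣ A B) ⟩
  ∣ A ∣ + closes A B                    ≡⟨ +-comm ∣ A ∣ _ ⟩
  closes A B + ∣ A ∣                    ≡⟨ closes+opens A B ⟩
  ∣ B ∣ + opens A B                     ∎)
  where open ≡-Reasoning

-- Suffix counts of A are bounded by those of B: nothing wraps when A is paired into B.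
Dominated : Subset n → Subset n → Set
Dominated []      []      = ⊤
Dominated (a ∷ A) (b ∷ B) = ∣ a ∷ A ∣ ≤ ∣ b ∷ B ∣ × Dominated A B

Dominated⇒≤ : ∀ (A B : Subset n) → Dominated A B → ∣ A ∣ ≤ ∣ B ∣
Dominated⇒≤ []      []      _       = z≤n
Dominated⇒≤ (_ ∷ _) (_ ∷ _) (p , _) = p

DominatedUpTo : (A B C D : Subset n) → Set
DominatedUpTo []      []      []      []      = ⊤
DominatedUpTo (a ∷ A) (b ∷ B) (c ∷ C) (d ∷ D) =
  ∣ a ∷ A ∣ ≤ ∣ b ∷ B ∣ + opens (c ∷ C) (d ∷ D) × DominatedUpTo A B C D

opens-tail : ∀ a b (A B : Subset n) → opens A B ≤ opens (a ∷ A) (b ∷ B)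
opens-tail true  true  A B = ≤-refl
opens-tail false b     A B = ≤-refl
opens-tail true  false A B with closes A B
... | zero  = n≤1+n _
... | suc _ = ≤-refl

-- `opens A B` is the largest excess of A over B on a suffix. It grows only at an opening bracket
-- that meets no unmatched closing one, and there `closes+opens` makes it equal to the excess of the
-- suffix that starts at this site.
DominatedUpTo⇒opens≤ : ∀ (A B C D : Subset n) → DominatedUpTo A B C D → opens A B ≤ opens C D
DominatedUpTo⇒opens≤ []      []      []      []      _ = z≤n
DominatedUpTo⇒opens≤ (true ∷ A) (false ∷ B) (c ∷ C) (d ∷ D) (p , q)
  with closes A B | closes+opens (true ∷ A) (false ∷ B) | DominatedUpTo⇒opens≤ A B C D q
... | zero  | e | _ = +-cancelˡ-≤ ∣ B ∣ _ _ (≤-trans (≤-reflexive (sym e)) p)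
... | suc _ | _ | r = ≤-trans r (opens-tail c d C D)
DominatedUpTo⇒opens≤ (true ∷ A)  (true ∷ B) (c ∷ C) (d ∷ D) (_ , q) = ≤-trans (DominatedUpTo⇒opens≤ A B C D q) (opens-tail c d C D)
DominatedUpTo⇒opens≤ (false ∷ A) (b ∷ B)    (c ∷ C) (d ∷ D) (_ , q) = ≤-trans (DominatedUpTo⇒opens≤ A B C D q) (opens-tail c d C D)

opens-self : ∀ (A : Subset n) → opens A A ≡ 0
opens-self []          = refl
opens-self (true ∷ A)  = opens-self A
opens-self (false ∷ A) = opens-self A

Dominated⇒opens≡0 : ∀ (A B : Subset n) → Dominated A B → opens A B ≡ 0
Dominated⇒opens≡0 A B d = n≤0⇒n≡0 (≤-trans (DominatedUpTo⇒opens≤ A B A A (weaken A B d)) (≤-reflexive (opens-self A)))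
  where
  weaken : ∀ {n} (A B : Subset n) → Dominated A B → DominatedUpTo A B A A
  weaken []      []      _       = tt
  weaken (_ ∷ A) (_ ∷ B) (p , d) = m≤n⇒m≤n+o _ p , weaken A B d

opens≡0⇒Dominated : ∀ (A B : Subset n) → opens A B ≡ 0 → Dominated A B
opens≡0⇒Dominated []      []      _ = tt
opens≡0⇒Dominated (a ∷ A) (b ∷ B) e =
  ≤-trans (m≤n+m _ (closes (a ∷ A) (b ∷ B)))
    (≤-reflexive (trans (closes+opens (a ∷ A) (b ∷ B)) (trans (cong (∣ b ∷ B ∣ +_) e) (+-identityʳ _)))) ,
  opens≡0⇒Dominated A B (n≤0⇒n≡0 (≤-trans (opens-tail a b A B) (≤-reflexive e)))

up≤B : ∀ (A B : Subset n) → ∣ up A B ∣ ≤ ∣ B ∣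
up≤B A B = ≤-trans (m≤m+n _ _) (≤-reflexive (∣up∣+closes A B))

Dominated-up-low : ∀ (A B : Subset n) → Dominated (up A B) (low A B)
Dominated-up-low []      []      = tt
Dominated-up-low (a ∷ A) (b ∷ B) =
  ≤-trans (up≤B (a ∷ A) (b ∷ B)) (≤-trans (m≤m+n _ _) (≤-reflexive (sym (∣low∣ (a ∷ A) (b ∷ B))))) , Dominated-up-low A B

-- The two cases of: a string that starts in a pair which is already dominated
-- moves no more balls than the string before it.
Dominated-raise-lower : ∀ (R₁ R₂ R₃ : Subset n) → Dominated R₂ R₁ → Dominated (up R₃ R₂) (up (low R₃ R₂) R₁)
Dominated-raise-lower R₁ R₂ R₃ d = go R₁ R₂ R₃ d
  where
  pre : ∀ {n} (R₁ R₂ R₃ : Subset n) → Dominated R₂ R₁ → DominatedUpTo (low R₃ R₂) R₁ R₃ R₂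
  pre []       []       []       _       = tt
  pre (a ∷ R₁) (b ∷ R₂) (c ∷ R₃) (p , d) =
    ≤-trans (≤-reflexive (∣low∣ (c ∷ R₃) (b ∷ R₂))) (+-monoˡ-≤ _ p) , pre R₁ R₂ R₃ d
  bound : ∀ {n} (R₁ R₂ R₃ : Subset n) → Dominated R₂ R₁ → ∣ up R₃ R₂ ∣ ≤ ∣ up (low R₃ R₂) R₁ ∣
  bound R₁ R₂ R₃ d = ≤-trans (up≤B R₃ R₂) (+-cancelʳ-≤ (opens R₃ R₂) _ _ (begin
    ∣ R₂ ∣ + opens R₃ R₂                           ≡⟨ ∣low∣ R₃ R₂ ⟨
    ∣ low R₃ R₂ ∣                                  ≡⟨ ∣up∣ (low R₃ R₂) R₁ ⟨
    ∣ up (low R₃ R₂) R₁ ∣ + opens (low R₃ R₂) R₁   ≤⟨ +-monoʳ-≤ _ (DominatedUpTo⇒opens≤ (low R₃ R₂) R₁ R₃ R₂ (pre R₁ R₂ R₃ d)) ⟩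
    ∣ up (low R₃ R₂) R₁ ∣ + opens R₃ R₂            ∎))
    where open ≤-Reasoning
  go : ∀ {n} (R₁ R₂ R₃ : Subset n) → Dominated R₂ R₁ → Dominated (up R₃ R₂) (up (low R₃ R₂) R₁)
  go []       []       []       _       = tt
  go (a ∷ R₁) (b ∷ R₂) (c ∷ R₃) (p , d) = bound (a ∷ R₁) (b ∷ R₂) (c ∷ R₃) (p , d) , go R₁ R₂ R₃ d

Dominated-lower-raise : ∀ (R₁ R₂ R₃ : Subset n) → Dominated R₃ R₂ → Dominated (low R₃ (up R₂ R₁)) (low R₂ R₁)
Dominated-lower-raise R₁ R₂ R₃ d = go R₁ R₂ R₃ d
  where
  pre : ∀ {n} (R₁ R₂ R₃ : Subset n) → Dominated R₃ R₂ → DominatedUpTo R₃ (up R₂ R₁) R₂ R₁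
  pre []       []       []       _       = tt
  pre (a ∷ R₁) (b ∷ R₂) (c ∷ R₃) (p , d) =
    ≤-trans p (≤-reflexive (sym (∣up∣ (b ∷ R₂) (a ∷ R₁)))) , pre R₁ R₂ R₃ d
  bound : ∀ {n} (R₁ R₂ R₃ : Subset n) → Dominated R₃ R₂ → ∣ low R₃ (up R₂ R₁) ∣ ≤ ∣ low R₂ R₁ ∣
  bound R₁ R₂ R₃ d = begin
    ∣ low R₃ (up R₂ R₁) ∣                ≡⟨ ∣low∣ R₃ (up R₂ R₁) ⟩
    ∣ up R₂ R₁ ∣ + opens R₃ (up R₂ R₁)   ≤⟨ +-mono-≤ (up≤B R₂ R₁) (DominatedUpTo⇒opens≤ R₃ (up R₂ R₁) R₂ R₁ (pre R₁ R₂ R₃ d)) ⟩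
    ∣ R₁ ∣ + opens R₂ R₁                 ≡⟨ ∣low∣ R₂ R₁ ⟨
    ∣ low R₂ R₁ ∣                        ∎
    where open ≤-Reasoning
  go : ∀ {n} (R₁ R₂ R₃ : Subset n) → Dominated R₃ R₂ → Dominated (low R₃ (up R₂ R₁)) (low R₂ R₁)
  go []       []       []       _       = tt
  go (a ∷ R₁) (b ∷ R₂) (c ∷ R₃) (p , d) = bound (a ∷ R₁) (b ∷ R₂) (c ∷ R₃) (p , d) , go R₁ R₂ R₃ d

-- Parking and the row reflection

-- The balls of A as cars parking in the places B, scanned left to right with c cars
-- already waiting.  With c the number of cars that wrap around, (rise , occupiedFrom)
-- is the row reflection.

occSite : ℕ → Bool → Bool → Bool
occSite _       _     false = false
occSite _       true  true  = true
occSite zero    false true  = false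
occSite (suc _) false true  = true

riseSite : ℕ → Bool → Bool → Bool
riseSite _       true  _     = true
riseSite _       false false = false
riseSite zero    false true  = true
riseSite (suc _) false true  = false

occupiedFrom : ℕ → Subset n → Subset n → Subset n
occupiedFrom c []      []      = []
occupiedFrom c (a ∷ A) (b ∷ B) = occSite c a b ∷ occupiedFrom (closeSite b a c) A B

rise : ℕ → Subset n → Subset n → Subset n
rise c []      []      = []
rise c (a ∷ A) (b ∷ B) = riseSite c a b ∷ rise (closeSite b a c) A B

-- The waiting cars take the leftmost unmatched places; only these stay below as unmatched closing
-- brackets, and the other unmatched places rise to the upper row.
closes-reflect : ∀ c (A B : Subset n) → closes (rise c A B) (occupiedFrom c A B) ≡ c ⊓ closes A B
closes-reflect c       []          []          = sym (⊓-zeroʳ c)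
closes-reflect c       (true ∷ A)  (true ∷ B)  = closes-reflect c A B
closes-reflect c       (true ∷ A)  (false ∷ B) rewrite closes-reflect (suc c) A B with closes A B
... | zero  = sym (⊓-zeroʳ c)
... | suc _ = refl
closes-reflect zero    (false ∷ A) (true ∷ B)  = cong pred (closes-reflect 0 A B)
closes-reflect (suc c) (false ∷ A) (true ∷ B)  = cong suc (closes-reflect c A B)
closes-reflect c       (false ∷ A) (false ∷ B) = closes-reflect c A B

-- Only unmatched balls rise, so the pair stays on its e↓-string and keeps the top of that string.
collapse-reflect : ∀ c (A B : Subset n) →
  up (rise c A B) (occupiedFrom c A B) ≡ up A B × low (rise c A B) (occupiedFrom c A B) ≡ low A B
collapse-reflect c [] [] = refl , refl
collapse-reflect c (true ∷ A) (true ∷ B) with collapse-reflect c A B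
... | e , f = cong (true ∷_) e , cong (true ∷_) f
collapse-reflect c (true ∷ A) (false ∷ B) rewrite closes-reflect (suc c) A B with closes A B | collapse-reflect (suc c) A B
... | zero  | e , f = cong (false ∷_) e , cong (true ∷_) f
... | suc _ | e , f = cong (true ∷_) e , cong (false ∷_) f
collapse-reflect zero (false ∷ A) (true ∷ B) rewrite closes-reflect 0 A B with collapse-reflect 0 A B
... | e , f = cong (false ∷_) e , cong (true ∷_) f
collapse-reflect (suc c) (false ∷ A) (true ∷ B) with collapse-reflect c A B
... | e , f = cong (false ∷_) e , cong (true ∷_) f
collapse-reflect c (false ∷ A) (false ∷ B) with collapse-reflect c A B
... | e , f = cong (false ∷_) e , cong (false ∷_) f

-- Unmatched closing brackets lie to the left of unmatched opening ones. At the top of the string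
-- all of them are below; letting the first `closes A B` stay and the rest rise undoes e↓⋆.
reflect-collapse : ∀ (A B : Subset n) →
  rise (closes A B) (up A B) (low A B) ≡ A × occupiedFrom (closes A B) (up A B) (low A B) ≡ B
reflect-collapse [] [] = refl , refl
reflect-collapse (true ∷ A) (true ∷ B) with reflect-collapse A B
... | e , f = cong (true ∷_) e , cong (true ∷_) f
reflect-collapse (true ∷ A) (false ∷ B) with closes A B | reflect-collapse A B
... | zero  | e , f = cong (true ∷_) e , cong (false ∷_) f
... | suc _ | e , f = cong (true ∷_) e , cong (false ∷_) f
reflect-collapse (false ∷ A) (true ∷ B) with reflect-collapse A B
... | e , f = cong (false ∷_) e , cong (true ∷_) f
reflect-collapse (false ∷ A) (false ∷ B) with reflect-collapse A B
... | e , f = cong (false ∷_) e , cong (false ∷_) f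

-- For S the lower row of a collapsed pair and U the part of S taken by the upper row, this restores
-- the lower row before the collapse. The balls that e↓⋆ brought down are the rightmost untaken
-- ones, hence the filling from the left.
fill : ℕ → Subset n → Subset n → Subset n
fill m       []          []          = []
fill m       (s ∷ S)     (true ∷ U)  = true ∷ fill m S U
fill m       (false ∷ S) (false ∷ U) = false ∷ fill m S U
fill zero    (true ∷ S)  (false ∷ U) = false ∷ fill zero S U
fill (suc m) (true ∷ S)  (false ∷ U) = true ∷ fill m S U

-- The c waiting cars already hold the first c unmatched closing brackets, so the filling has only
-- the remaining ones to supply.
fill-low : ∀ c (A B : Subset n) → c ≤ closes A B →
  fill (closes A B ∸ c) (low A B) (occupiedFrom c (up A B) (low A B)) ≡ B
fill-low c [] [] _ = refl
fill-low c (true ∷ A) (true ∷ B) p = cong (true ∷_) (fill-low c A B p)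
fill-low c (true ∷ A) (false ∷ B) p with closes A B | fill-low (suc c) A B | fill-low 0 A B
fill-low .0 (true ∷ A) (false ∷ B) z≤n | zero  | _ | h = cong (false ∷_) (h z≤n)
fill-low c  (true ∷ A) (false ∷ B) p   | suc u | h | _ = cong (false ∷_) (h (s≤s p))
fill-low zero    (false ∷ A) (true ∷ B) p       = cong (true ∷_) (fill-low 0 A B z≤n)
fill-low (suc c) (false ∷ A) (true ∷ B) (s≤s p) = cong (true ∷_) (fill-low c A B p)
fill-low c (false ∷ A) (false ∷ B) p = cong (false ∷_) (fill-low c A B p)

data _⊑_ : Subset n → Subset n → Set where
  []   : [] ⊑ []
  skip : ∀ {s} {U S : Subset n} → U ⊑ S → (false ∷ U) ⊑ (s ∷ S)
  both : ∀ {U S : Subset n} → U ⊑ S → (true ∷ U) ⊑ (true ∷ S)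

-- Invariant of the scan: among the waiting cars, c belong to U, x to fill m S U but
-- not to U, and y only to S; since filling goes from the left, y > 0 forces m = 0.
fill₀-occupiedFrom : ∀ x y c {S U : Subset n} r → U ⊑ S →
  fill x (occupiedFrom (y + (x + c)) S r) (occupiedFrom c U r) ≡ occupiedFrom (x + c) (fill 0 S U) r
fill₀-occupiedFrom x y c [] [] = refl
fill₀-occupiedFrom x y c (false ∷ r) (both p)
  rewrite sym (+-suc x c) | sym (+-suc y (x + c)) | sym (+-suc x c) = cong (false ∷_) (fill₀-occupiedFrom x y (suc c) r p)
fill₀-occupiedFrom x y c (true ∷ r) (both p) = cong (true ∷_) (fill₀-occupiedFrom x y c r p)
fill₀-occupiedFrom x y c (false ∷ r) (skip {s = true}  p) = cong (false ∷_) (fill₀-occupiedFrom x (suc y) c r p)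
fill₀-occupiedFrom x y c (false ∷ r) (skip {s = false} p) = cong (false ∷_) (fill₀-occupiedFrom x y c r p)
fill₀-occupiedFrom x y (suc c) (true ∷ r) (skip {s = true} p)
  rewrite +-suc x c | +-suc y (x + c) = cong (true ∷_) (fill₀-occupiedFrom x (suc y) c r p)
fill₀-occupiedFrom (suc x) y zero (true ∷ r) (skip {s = true} p)
  rewrite +-suc y (x + 0) = cong (true ∷_) (fill₀-occupiedFrom x (suc y) 0 r p)
fill₀-occupiedFrom zero y zero (true ∷ r) (skip {s = true} p) = cong (false ∷_) (fill₀-occupiedFrom 0 y 0 r p)
fill₀-occupiedFrom x y (suc c) (true ∷ r) (skip {s = false} p)
  rewrite +-suc x c | +-suc y (x + c) = cong (true ∷_) (fill₀-occupiedFrom x y c r p)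
fill₀-occupiedFrom (suc x) y zero (true ∷ r) (skip {s = false} p)
  rewrite +-suc y (x + 0) = cong (true ∷_) (fill₀-occupiedFrom x y 0 r p)
fill₀-occupiedFrom zero (suc y) zero (true ∷ r) (skip {s = false} p) = cong (false ∷_) (fill₀-occupiedFrom 0 y 0 r p)
fill₀-occupiedFrom zero zero zero (true ∷ r) (skip {s = false} p) = cong (false ∷_) (fill₀-occupiedFrom 0 0 0 r p)

-- As long as m > 0, every element of S that is met enters the filled set as well, so no car waits
-- for S alone (y = 0). When m is used up, `fill₀-occupiedFrom` takes over.
fill-occupiedFrom : ∀ m x c {S U : Subset n} r → U ⊑ S →
  fill (m + x) (occupiedFrom (x + c) S r) (occupiedFrom c U r) ≡ occupiedFrom (x + c) (fill m S U) r
fill-occupiedFrom zero    x c r p = fill₀-occupiedFrom x 0 c r p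
fill-occupiedFrom (suc m) x c [] [] = refl
fill-occupiedFrom (suc m) x c (false ∷ r) (both p)
  rewrite sym (+-suc x c) = cong (false ∷_) (fill-occupiedFrom (suc m) x (suc c) r p)
fill-occupiedFrom (suc m) x c (true ∷ r) (both p) = cong (true ∷_) (fill-occupiedFrom (suc m) x c r p)
fill-occupiedFrom (suc m) x c (false ∷ r) (skip {s = true} p)
  rewrite sym (+-suc m x) = cong (false ∷_) (fill-occupiedFrom m (suc x) c r p)
fill-occupiedFrom (suc m) x (suc c) (true ∷ r) (skip {s = true} p)
  rewrite sym (+-suc m x) | +-suc x c = cong (true ∷_) (fill-occupiedFrom m (suc x) c r p)
fill-occupiedFrom (suc m) x zero (true ∷ r) (skip {s = true} p) = cong (true ∷_) (fill-occupiedFrom m x 0 r p)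
fill-occupiedFrom (suc m) x c (false ∷ r) (skip {s = false} p) = cong (false ∷_) (fill-occupiedFrom (suc m) x c r p)
fill-occupiedFrom (suc m) x (suc c) (true ∷ r) (skip {s = false} p)
  rewrite +-suc x c = cong (true ∷_) (fill-occupiedFrom (suc m) x c r p)
fill-occupiedFrom (suc m) (suc x) zero (true ∷ r) (skip {s = false} p)
  rewrite +-suc m x = cong (true ∷_) (fill-occupiedFrom (suc m) x 0 r p)
fill-occupiedFrom (suc m) zero zero (true ∷ r) (skip {s = false} p) = cong (false ∷_) (fill-occupiedFrom (suc m) 0 0 r p)

carryOut : ℕ → Subset n → Subset n → ℕ
carryOut c []      []      = c
carryOut c (a ∷ A) (b ∷ B) = carryOut (closeSite b a c) A B

carryOut-∣occupiedFrom∣ : ∀ c (A B : Subset n) → carryOut c A B + ∣ occupiedFrom c A B ∣ ≡ c + ∣ A ∣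
carryOut-∣occupiedFrom∣ c       []          []          = refl
carryOut-∣occupiedFrom∣ c       (true ∷ A)  (true ∷ B)  = trans (+-suc _ _) (trans (cong suc (carryOut-∣occupiedFrom∣ c A B)) (sym (+-suc _ _)))
carryOut-∣occupiedFrom∣ c       (true ∷ A)  (false ∷ B) = trans (carryOut-∣occupiedFrom∣ (suc c) A B) (sym (+-suc _ _))
carryOut-∣occupiedFrom∣ zero    (false ∷ A) (true ∷ B)  = carryOut-∣occupiedFrom∣ 0 A B
carryOut-∣occupiedFrom∣ (suc c) (false ∷ A) (true ∷ B)  = trans (+-suc _ _) (cong suc (carryOut-∣occupiedFrom∣ c A B))
carryOut-∣occupiedFrom∣ c       (false ∷ A) (false ∷ B) = carryOut-∣occupiedFrom∣ c A B

-- The unmatched places precede the unmatched cars: they absorb waiting cars only, and all unmatched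
-- cars leave.
carryOut-opens : ∀ c (A B : Subset n) → carryOut c A B ≡ opens A B + (c ∸ closes A B)
carryOut-opens c       []          []          = refl
carryOut-opens c       (true ∷ A)  (true ∷ B)  = carryOut-opens c A B
carryOut-opens c       (true ∷ A)  (false ∷ B) with closes A B | carryOut-opens (suc c) A B
... | zero  | e = trans e (+-suc _ _)
... | suc _ | e = e
carryOut-opens zero    (false ∷ A) (true ∷ B)  = trans (carryOut-opens 0 A B) (cong (opens A B +_) (0∸n≡0 (closes A B)))
carryOut-opens (suc c) (false ∷ A) (true ∷ B)  = carryOut-opens c A B
carryOut-opens c       (false ∷ A) (false ∷ B) = carryOut-opens c A B

occupiedFrom-full : ∀ c (A B : Subset n) → closes A B ≤ c → occupiedFrom c A B ≡ B
occupiedFrom-full c       []          []          _       = refl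
occupiedFrom-full c       (true ∷ A)  (true ∷ B)  p       = cong (true ∷_) (occupiedFrom-full c A B p)
occupiedFrom-full c       (true ∷ A)  (false ∷ B) p       = cong (false ∷_) (occupiedFrom-full (suc c) A B (pred≤ p))
  where
  pred≤ : ∀ {m} → pred m ≤ c → m ≤ suc c
  pred≤ {zero}  _ = z≤n
  pred≤ {suc m} p = s≤s p
occupiedFrom-full (suc c) (false ∷ A) (true ∷ B)  (s≤s p) = cong (true ∷_) (occupiedFrom-full c A B p)
occupiedFrom-full c       (false ∷ A) (false ∷ B) p       = cong (false ∷_) (occupiedFrom-full c A B p)

occupied : Subset n → Subset n → Subset n
occupied A B = occupiedFrom (opens A B) A B

-- One turn sends c to `opens A B + (c ∸ closes A B)`. A fixed point is either `opens A B` itself,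
-- or at least `closes A B` with `opens A B ≡ closes A B`; in the latter case every place is taken
-- for both starting values.
occupiedFrom-fixed : ∀ c (A B : Subset n) → carryOut c A B ≡ c → occupiedFrom c A B ≡ occupied A B
occupiedFrom-fixed c A B e with ≤-total c (closes A B)
... | inj₁ c≤ = cong (λ m → occupiedFrom m A B) (begin
    c                              ≡⟨ e ⟨
    carryOut c A B                      ≡⟨ carryOut-opens c A B ⟩
    opens A B + (c ∸ closes A B)   ≡⟨ cong (opens A B +_) (m≤n⇒m∸n≡0 c≤) ⟩
    opens A B + 0                  ≡⟨ +-identityʳ _ ⟩
    opens A B                      ∎)
  where open ≡-Reasoning
... | inj₂ ≤c = trans (occupiedFrom-full c A B ≤c) (sym (occupiedFrom-full (opens A B) A B (≤-reflexive (sym opens≡closes))))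
  where
  open ≡-Reasoning
  opens≡closes : opens A B ≡ closes A B
  opens≡closes = +-cancelʳ-≡ (c ∸ closes A B) _ _ (begin
    opens A B + (c ∸ closes A B)   ≡⟨ carryOut-opens c A B ⟨
    carryOut c A B                      ≡⟨ e ⟩
    c                              ≡⟨ m+[n∸m]≡n ≤c ⟨
    closes A B + (c ∸ closes A B)  ∎)

occupiedFrom⊑ : ∀ c (A B : Subset n) → occupiedFrom c A B ⊑ B
occupiedFrom⊑ c       []          []          = []
occupiedFrom⊑ c       (a ∷ A)     (false ∷ B) = skip (occupiedFrom⊑ _ A B)
occupiedFrom⊑ c       (true ∷ A)  (true ∷ B)  = both (occupiedFrom⊑ c A B)
occupiedFrom⊑ zero    (false ∷ A) (true ∷ B)  = skip (occupiedFrom⊑ 0 A B)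
occupiedFrom⊑ (suc c) (false ∷ A) (true ∷ B)  = both (occupiedFrom⊑ c A B)

-- Parking one car at a time

nextFrom : ℕ → Subset n → Maybe ℕ
nextFrom j       []          = nothing
nextFrom zero    (true ∷ v)  = just 0
nextFrom zero    (false ∷ v) = Maybe.map suc (nextFrom 0 v)
nextFrom (suc j) (_ ∷ v)     = Maybe.map suc (nextFrom j v)

free : Subset n → Subset n → Subset n
free []      []      = []
free (b ∷ B) (o ∷ O) = (b ∧ not o) ∷ free B O

ParkedAt : Maybe ℕ → Subset n → Subset n → ℕ → ℕ → Set
ParkedAt (just k) O O′ f f′ = O′ ≡ setV O k true × f′ ≡ f
ParkedAt nothing  O O′ f f′ = O′ ≡ O × f′ ≡ suc f

shift : ∀ m {o} {O O′ : Subset n} {f f′} → ParkedAt m O O′ f f′ → ParkedAt (Maybe.map suc m) (o ∷ O) (o ∷ O′) f f′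
shift (just k) {o} (e , e′) = cong (o ∷_) e , e′
shift nothing  {o} (e , e′) = cong (o ∷_) e , e′

-- Cars are interchangeable, so the additional one may be thought of as arriving last: it stops at
-- the first place that the others left free. `occupiedFrom-insert` is the same argument for a car
-- that starts at j.
occupiedFrom-suc : ∀ c (A B : Subset n) →
  ParkedAt (nextFrom 0 (free B (occupiedFrom c A B))) (occupiedFrom c A B) (occupiedFrom (suc c) A B) (carryOut c A B) (carryOut (suc c) A B)
occupiedFrom-suc c       []          []          = refl , refl
occupiedFrom-suc c       (true ∷ A)  (true ∷ B)  = shift (nextFrom 0 (free B _)) (occupiedFrom-suc c A B)
occupiedFrom-suc c       (true ∷ A)  (false ∷ B) = shift (nextFrom 0 (free B _)) (occupiedFrom-suc (suc c) A B)
occupiedFrom-suc zero    (false ∷ A) (true ∷ B)  = refl , refl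
occupiedFrom-suc (suc c) (false ∷ A) (true ∷ B)  = shift (nextFrom 0 (free B _)) (occupiedFrom-suc c A B)
occupiedFrom-suc c       (false ∷ A) (false ∷ B) = shift (nextFrom 0 (free B _)) (occupiedFrom-suc c A B)

occupiedFrom-insert : ∀ j c (A B : Subset n) → j < n → getV A j ≡ false →
  ParkedAt (nextFrom j (free B (occupiedFrom c A B))) (occupiedFrom c A B) (occupiedFrom c (setV A j true) B) (carryOut c A B) (carryOut c (setV A j true) B)
occupiedFrom-insert zero    c       (false ∷ A) (false ∷ B) _       _ = shift (nextFrom 0 (free B _)) (occupiedFrom-suc c A B)
occupiedFrom-insert zero    zero    (false ∷ A) (true ∷ B)  _       _ = refl , refl
occupiedFrom-insert zero    (suc c) (false ∷ A) (true ∷ B)  _       _ = shift (nextFrom 0 (free B _)) (occupiedFrom-suc c A B)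
occupiedFrom-insert (suc j) c       (a ∷ A)     (b ∷ B)     (s≤s p) e = shift (nextFrom j (free B _)) (occupiedFrom-insert j _ A B p e)

nextFrom-free-full : ∀ j (B : Subset n) → nextFrom j (free B B) ≡ nothing
nextFrom-free-full j       []          = refl
nextFrom-free-full zero    (true ∷ B)  rewrite nextFrom-free-full 0 B = refl
nextFrom-free-full zero    (false ∷ B) rewrite nextFrom-free-full 0 B = refl
nextFrom-free-full (suc j) (b ∷ B)     rewrite nextFrom-free-full j B = refl

nextFrom-free-nothing : {O B : Subset n} → O ⊑ B → nextFrom 0 (free B O) ≡ nothing → O ≡ B
nextFrom-free-nothing []                   _ = refl
nextFrom-free-nothing (skip {s = false} {U = O} {S = B} p) e with nextFrom 0 (free B O) in eq
... | nothing = cong (false ∷_) (nextFrom-free-nothing p eq)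
nextFrom-free-nothing (both {U = O} {S = B} p) e with nextFrom 0 (free B O) in eq
... | nothing = cong (true ∷_) (nextFrom-free-nothing p eq)

∣insert∣ : ∀ j (A : Subset n) → j < n → getV A j ≡ false → ∣ setV A j true ∣ ≡ suc ∣ A ∣
∣insert∣ zero    (false ∷ A) _       _ = refl
∣insert∣ (suc j) (true ∷ A)  (s≤s p) e = cong suc (∣insert∣ j A p e)
∣insert∣ (suc j) (false ∷ A) (s≤s p) e = ∣insert∣ j A p e

-- Either the carry c reproduces itself after one turn around the cycle, or every
-- place is taken; parking one more car preserves this disjunction.
Parking : Subset n → Subset n → Subset n → Set
Parking A B O = (∃ λ c → carryOut c A B ≡ c × O ≡ occupiedFrom c A B) ⊎ (O ≡ B × ∣ B ∣ ≤ ∣ A ∣)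

place : Maybe ℕ → Subset n → Subset n
place (just k) O = setV O k true
place nothing  O = O

spot : ℕ → Subset n → Maybe ℕ
spot j v = nextFrom j v <∣> nextFrom 0 v

-- A car that finds no place from j on leaves at the right end and re-enters at the left, which
-- turns the self-reproducing carry c into `suc c`. If it finds no place there either, all of B is
-- taken.
Parking-insert : ∀ j (A B O : Subset n) → j < n → getV A j ≡ false → Parking A B O →
  Parking (setV A j true) B (place (spot j (free B O)) O)
Parking-insert j A B O j<n e (inj₂ (refl , B≤A))
  rewrite nextFrom-free-full j B | nextFrom-free-full 0 B
  = inj₂ (refl , ≤-trans B≤A (≤-trans (n≤1+n _) (≤-reflexive (sym (∣insert∣ j A j<n e)))))
Parking-insert j A B O j<n e (inj₁ (c , fix , refl))
  with nextFrom j (free B (occupiedFrom c A B)) | occupiedFrom-insert j c A B j<n e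
... | just k  | eo , ef = inj₁ (c , trans ef fix , sym eo)
... | nothing | eo , ef with nextFrom 0 (free B (occupiedFrom c A B)) in eq | occupiedFrom-suc c (setV A j true) B
...   | m | par rewrite eo | eq with m | par
...     | just k  | po , pf = inj₁ (suc c , trans pf (trans ef (cong suc fix)) , sym po)
...     | nothing | _       = inj₂ (full , (begin
          ∣ B ∣              ≡⟨ cong ∣_∣ full ⟨
          ∣ occupiedFrom c A B ∣      ≡⟨ +-cancelˡ-≡ c _ _ (trans (cong (_+ ∣ occupiedFrom c A B ∣) (sym fix)) (carryOut-∣occupiedFrom∣ c A B)) ⟩
          ∣ A ∣              ≤⟨ n≤1+n _ ⟩
          suc ∣ A ∣          ≡⟨ ∣insert∣ j A j<n e ⟨
          ∣ setV A j true ∣  ∎))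
  where
  open ≤-Reasoning
  full : occupiedFrom c A B ≡ B
  full = nextFrom-free-nothing (occupiedFrom⊑ c A B) eq

Parking⇒occupied : ∀ (A B O : Subset n) → ∣ A ∣ ≤ ∣ B ∣ → Parking A B O → O ≡ occupied A B
Parking⇒occupied A B O _   (inj₁ (c , fix , refl)) = occupiedFrom-fixed c A B fix
Parking⇒occupied A B O A≤B (inj₂ (refl , B≤A)) = sym (occupiedFrom-full (opens A B) A B (+-cancelʳ-≤ ∣ A ∣ _ _ (begin
  closes A B + ∣ A ∣  ≡⟨ closes+opens A B ⟩
  ∣ B ∣ + opens A B   ≡⟨ +-comm ∣ B ∣ _ ⟩
  opens A B + ∣ B ∣   ≤⟨ +-monoʳ-≤ _ B≤A ⟩
  opens A B + ∣ A ∣   ∎)))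
  where open ≤-Reasoning

carryOut-∅ : (B : Subset n) → carryOut 0 ∅ B ≡ 0
carryOut-∅ []          = refl
carryOut-∅ (true ∷ B)  = carryOut-∅ B
carryOut-∅ (false ∷ B) = carryOut-∅ B

occupiedFrom-∅ : (B : Subset n) → occupiedFrom 0 ∅ B ≡ ∅
occupiedFrom-∅ []          = refl
occupiedFrom-∅ (true ∷ B)  = cong (false ∷_) (occupiedFrom-∅ B)
occupiedFrom-∅ (false ∷ B) = cong (false ∷_) (occupiedFrom-∅ B)

occupied-∅ : (B : Subset n) → occupied ∅ B ≡ ∅
occupied-∅ B = trans (sym (occupiedFrom-fixed 0 ∅ B (carryOut-∅ B))) (occupiedFrom-∅ B)

Parking-∅ : (B : Subset n) → Parking ∅ B ∅
Parking-∅ B = inj₁ (0 , carryOut-∅ B , sym (occupiedFrom-∅ B))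

-- Nonwrapping configurations and their uniqueness

HeadDominated : Config n → Set
HeadDominated (B ∷ A ∷ _) = Dominated A B
HeadDominated _           = ⊤

Nonwrapping : Config n → Set
Nonwrapping []      = ⊤
Nonwrapping (r ∷ M) = HeadDominated (r ∷ M) × Nonwrapping M

HeadDominated-moveRight : ∀ k → suc k < n → (M : Config n) → HeadDominated M → HeadDominated (moveRight k M)
HeadDominated-moveRight k k<n []          _ = tt
HeadDominated-moveRight k k<n (B ∷ [])    _ with eligibleAt k B []
... | true  = tt
... | false = tt
HeadDominated-moveRight k k<n (B ∷ A ∷ M) d rewrite moveRight-two k B A M =
  opens≡0⇒Dominated _ _ (trans (MovePair.same-opens k (openCount k M) 0 A B k<n) (Dominated⇒opens≡0 A B d))

Nonwrapping-moveRight : ∀ k → suc k < n → (M : Config n) → Nonwrapping M → Nonwrapping (moveRight k M)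
Nonwrapping-moveRight k k<n []      _       = tt
Nonwrapping-moveRight k k<n (r ∷ M) (d , h) with eligibleAt k r M | HeadDominated-moveRight k k<n (r ∷ M) d
... | true  | d′ = d′ , h
... | false | d′ = d′ , Nonwrapping-moveRight k k<n M h

infix 4 _↝_
-- `rhoN` and `collapse` apply the operators e↓⋆ in different orders. Only reachability is recorded,
-- and uniqueness of the nonwrapping end identifies the two results.
data _↝_ {n} : Config n → Config n → Set where
  done : ∀ {M} → M ↝ M
  step : ∀ {M N} j → lowerAll j M ↝ N → M ↝ N

↝-trans : {M N P : Config n} → M ↝ N → N ↝ P → M ↝ P
↝-trans done       q = q
↝-trans (step j p) q = step j (↝-trans p q)

↝-cons : ∀ r {M N : Config n} → M ↝ N → r ∷ M ↝ r ∷ N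
↝-cons r done       = done
↝-cons r (step j p) = step (suc j) (↝-cons r p)

↝-moveRight : ∀ k → suc k < n → {M N : Config n} → M ↝ N → moveRight k M ↝ moveRight k N
↝-moveRight k k<n done = done
↝-moveRight k k<n (step {M} j p) = step j (subst (_↝ _) (sym (moveRight-lowerAll k k<n j M)) (↝-moveRight k k<n p))

openCount-↝ : ∀ k → suc k < n → {M N : Config n} → M ↝ N → openCount k N ≡ openCount k M
openCount-↝ k k<n done = refl
openCount-↝ k k<n (step {M} j p) = trans (openCount-↝ k k<n p) (openCount-lowerAll k k<n j M)

closeCount-↝ : ∀ k → suc k < n → {M N : Config n} → M ↝ N → closeCount k N ≡ closeCount k M
closeCount-↝ k k<n done = refl
closeCount-↝ k k<n (step {M} j p) = trans (closeCount-↝ k k<n p) (closeCount-lowerAll k k<n j M)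

bit : Bool → ℕ
bit true  = 1
bit false = 0

columnCount : ℕ → Config n → ℕ
columnCount c []      = 0
columnCount c (r ∷ M) = bit (getV r c) + columnCount c M

bits-collapse : ∀ c (A B : Subset n) → bit (getV (low A B) c) + bit (getV (up A B) c) ≡ bit (getV B c) + bit (getV A c)
bits-collapse c       []          []          = refl
bits-collapse zero    (true ∷ A)  (true ∷ B)  = refl
bits-collapse zero    (false ∷ A) (b ∷ B)     = refl
bits-collapse zero    (true ∷ A)  (false ∷ B) with closes A B
... | zero  = refl
... | suc _ = refl
bits-collapse (suc c) (a ∷ A)     (b ∷ B)     = bits-collapse c A B

columnCount-lowerAll : ∀ c j (M : Config n) → columnCount c (lowerAll j M) ≡ columnCount c M
columnCount-lowerAll c zero    []          = refl
columnCount-lowerAll c (suc j) []          = refl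
columnCount-lowerAll c zero    (B ∷ [])    = refl
columnCount-lowerAll c zero    (B ∷ A ∷ M) = trans (sym (+-assoc (bit (getV (low A B) c)) _ _))
  (trans (cong (_+ columnCount c M) (bits-collapse c A B)) (+-assoc (bit (getV B c)) _ _))
columnCount-lowerAll c (suc j) (r ∷ M)     = cong (bit (getV r c) +_) (columnCount-lowerAll c j M)

columnCount-↝ : ∀ c {M N : Config n} → M ↝ N → columnCount c N ≡ columnCount c M
columnCount-↝ c done = refl
columnCount-↝ c (step {M} j p) = trans (columnCount-↝ c p) (columnCount-lowerAll c j M)

length-lowerAll : ∀ j (M : Config n) → length (lowerAll j M) ≡ length M
length-lowerAll zero    []          = refl
length-lowerAll (suc j) []          = refl
length-lowerAll zero    (B ∷ [])    = refl
length-lowerAll zero    (B ∷ A ∷ M) = refl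
length-lowerAll (suc j) (r ∷ M)     = cong suc (length-lowerAll j M)

length-↝ : {M N : Config n} → M ↝ N → length N ≡ length M
length-↝ done = refl
length-↝ (step {M} j p) = trans (length-↝ p) (length-lowerAll j M)

eligible-true : ∀ q p c → eligible q p c ≡ true → q ≡ true × p ≡ false × c ≡ 0
eligible-true true false zero _ = refl , refl , refl

getV-moveIf : ∀ k (v : Subset n) → suc k < n → getV (moveIf true k v) k ≡ false × getV (moveIf true k v) (suc k) ≡ true
getV-moveIf zero    (_ ∷ _ ∷ _) _       = refl , refl
getV-moveIf zero    (_ ∷ [])    (s≤s ())
getV-moveIf (suc k) (_ ∷ v)     (s≤s p) = getV-moveIf k v p

moveIf-injective : ∀ k (u v : Subset n) → getV u k ≡ true → getV u (suc k) ≡ false → getV v k ≡ true → getV v (suc k) ≡ false →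
  moveIf true k u ≡ moveIf true k v → u ≡ v
moveIf-injective zero    (true ∷ false ∷ u) (true ∷ false ∷ v) _ _ _ _ e = cong (λ w → true ∷ false ∷ w) (Vec.∷-injectiveʳ (Vec.∷-injectiveʳ e))
moveIf-injective zero    (true ∷ [])        (true ∷ [])        _ _ _ _ e = refl
moveIf-injective (suc k) (a ∷ u)            (b ∷ v)            p q r s e =
  cong₂ _∷_ (Vec.∷-injectiveˡ e) (moveIf-injective k u v p q r s (Vec.∷-injectiveʳ e))

openCount-moveRight : ∀ k → suc k < n → (M : Config n) → closeCount k M ≢ 0 → openCount k (moveRight k M) ≡ suc (openCount k M)
openCount-moveRight k k<n []      c = contradiction refl c
openCount-moveRight k k<n (r ∷ M) c with eligible (getV r k) (getV r (suc k)) (openCount k M) in eq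
... | true with eligible-true (getV r k) (getV r (suc k)) (openCount k M) eq
...   | q , p , z rewrite q | p | z | proj₁ (getV-moveIf k r k<n) | proj₂ (getV-moveIf k r k<n) = refl
openCount-moveRight k k<n (r ∷ M) c | false rewrite moveIf-false k r | openCount-moveRight k k<n M c
  with getV r k | getV r (suc k) | openCount k M
... | true  | true  | _     = refl
... | false | true  | _     = refl
... | false | false | _     = refl
... | true  | false | suc _ = refl

-- A move turns an unmatched closing bracket into an unmatched opening one. If one side moved its
-- bottom row and the other a higher row, the equal tails would have open count 0 on the first side
-- and a positive one on the second.
moveRight-injective : ∀ k → suc k < n → (M N : Config n) → closeCount k M ≢ 0 → closeCount k N ≢ 0 → moveRight k M ≡ moveRight k N → M ≡ N
moveRight-injective k k<n []      N       c d e = contradiction refl c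
moveRight-injective k k<n (r ∷ M) []      c d e = contradiction refl d
moveRight-injective k k<n (r ∷ M) (s ∷ N) c d e
  with eligible (getV r k) (getV r (suc k)) (openCount k M) in eq | eligible (getV s k) (getV s (suc k)) (openCount k N) in eq′
... | true | true with eligible-true (getV r k) (getV r (suc k)) (openCount k M) eq | eligible-true (getV s k) (getV s (suc k)) (openCount k N) eq′
...   | q , p , _ | q′ , p′ , _ = cong₂ _∷_ (moveIf-injective k r s q p q′ p′ (∷-injectiveˡ e)) (∷-injectiveʳ e)
moveRight-injective k k<n (r ∷ M) (s ∷ N) c d e | true | false
  with () ← trans (sym (openCount-moveRight k k<n N d)) (trans (cong (openCount k) (sym (∷-injectiveʳ e))) (proj₂ (proj₂ (eligible-true (getV r k) (getV r (suc k)) (openCount k M) eq))))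
moveRight-injective k k<n (r ∷ M) (s ∷ N) c d e | false | true
  with () ← trans (sym (openCount-moveRight k k<n M c)) (trans (cong (openCount k) (∷-injectiveʳ e)) (proj₂ (proj₂ (eligible-true (getV s k) (getV s (suc k)) (openCount k N) eq′))))
moveRight-injective k k<n (r ∷ M) (s ∷ N) c d e | false | false rewrite moveIf-false k r | moveIf-false k s =
  cong₂ _∷_ (∷-injectiveˡ e) (moveRight-injective k k<n M N c d (∷-injectiveʳ e))

rowPotential : ∀ {n} → Subset n → ℕ
rowPotential          []          = 0
rowPotential {suc n} (true ∷ v)  = suc n + rowPotential v
rowPotential         (false ∷ v) = rowPotential v

potential : Config n → ℕ
potential []      = 0
potential (r ∷ M) = rowPotential r + potential M

rowPotential-move : ∀ k (v : Subset n) → suc k < n → getV v k ≡ true → getV v (suc k) ≡ false →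
  suc (rowPotential (moveIf true k v)) ≡ rowPotential v
rowPotential-move zero    (true ∷ false ∷ v) _       _ _ = refl
rowPotential-move zero    (_ ∷ []) (s≤s ())
rowPotential-move {suc n} (suc k) (true ∷ v) (s≤s p) q r =
  trans (sym (+-suc (suc n) _)) (cong (suc n +_) (rowPotential-move k v p q r))
rowPotential-move (suc k) (false ∷ v)        (s≤s p) q r = rowPotential-move k v p q r

potential-moveRight : ∀ k → suc k < n → (M : Config n) → closeCount k M ≢ 0 → suc (potential (moveRight k M)) ≡ potential M
potential-moveRight k k<n []      c = contradiction refl c
potential-moveRight k k<n (r ∷ M) c with eligible (getV r k) (getV r (suc k)) (openCount k M) in eq
... | true with eligible-true (getV r k) (getV r (suc k)) (openCount k M) eq
...   | q , p , _ = cong (_+ potential M) (rowPotential-move k r k<n q p)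
potential-moveRight k k<n (r ∷ M) c | false rewrite moveIf-false k r =
  trans (sym (+-suc _ _)) (cong (rowPotential r +_) (potential-moveRight k k<n M c))

RightJustified : ∀ {n} → Subset n → Set
RightJustified {n} r = ∀ k → suc k < n → getV r k ≡ true → getV r (suc k) ≡ true

Nested : Config n → Set
Nested []      = ⊤
Nested (r ∷ M) = RightJustified r × All (_⊑ r) M × Nested M

Lowest : Config n → Set
Lowest {n} M = ∀ k → suc k < n → closeCount k M ≡ 0

⊑-refl : (A : Subset n) → A ⊑ A
⊑-refl []          = []
⊑-refl (true ∷ A)  = both (⊑-refl A)
⊑-refl (false ∷ A) = skip (⊑-refl A)

⊑-trans : {A B C : Subset n} → A ⊑ B → B ⊑ C → A ⊑ C
⊑-trans []       []       = []
⊑-trans (skip p) (skip q) = skip (⊑-trans p q)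
⊑-trans (skip p) (both q) = skip (⊑-trans p q)
⊑-trans (both p) (both q) = both (⊑-trans p q)

getV-⊑ : {A B : Subset n} → A ⊑ B → ∀ k → getV B k ≡ false → getV A k ≡ false
getV-⊑ []       k       e = refl
getV-⊑ (skip p) zero    e = refl
getV-⊑ (skip p) (suc k) e = getV-⊑ p k e
getV-⊑ (both p) (suc k) e = getV-⊑ p k e

RightJustified-full : ∀ (A : Subset n) → RightJustified (true ∷ A) → ∣ A ∣ ≡ n
RightJustified-full []          _ = refl
RightJustified-full (true ∷ A)  h = cong suc (RightJustified-full A (λ k p → h (suc k) (s≤s p)))
RightJustified-full (false ∷ A) h with () ← h 0 (s≤s (s≤s z≤n)) refl

-- From any ball of A on, A is full to the right end; domination then forces B to be full there too.
Dominated-RightJustified : ∀ (A B : Subset n) → RightJustified A → Dominated A B → A ⊑ B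
Dominated-RightJustified []          []          _ _ = []
Dominated-RightJustified (false ∷ A) (b ∷ B)     h (_ , d) = skip (Dominated-RightJustified A B (λ k p → h (suc k) (s≤s p)) d)
Dominated-RightJustified (true ∷ A)  (true ∷ B)  h (_ , d) = both (Dominated-RightJustified A B (λ k p → h (suc k) (s≤s p)) d)
Dominated-RightJustified (true ∷ A)  (false ∷ B) h (p , d) =
  contradiction (≤-trans (≤-trans (≤-reflexive (cong suc (sym (RightJustified-full A h)))) p) (∣p∣≤n B)) (n≮n _)

openCount-empty : ∀ k (M : Config n) → All (λ r → getV r (suc k) ≡ false) M → openCount k M ≡ 0
openCount-empty k []      []       = refl
openCount-empty k (r ∷ M) (e ∷ es) rewrite e | openCount-empty k M es with getV r k
... | true  = refl
... | false = refl

closeCount-tail : ∀ k r (M : Config n) → closeCount k (r ∷ M) ≡ 0 → closeCount k M ≡ 0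
closeCount-tail k r M e with eligible (getV r k) (getV r (suc k)) (openCount k M)
... | false = e

-- Treat the upper rows first; they are then contained in the bottom row. If the bottom row had a
-- ball in column k and none in column k + 1, no upper row would have one in column k + 1 either,
-- and that ball would be an unmatched closing bracket.
Nonwrapping-Lowest⇒Nested : (M : Config n) → Nonwrapping M → Lowest M → Nested M
Nonwrapping-Lowest⇒Nested []      _       _ = tt
Nonwrapping-Lowest⇒Nested (r ∷ M) (d , h) l = rj , sub , rest
  where
  rest : Nested M
  rest = Nonwrapping-Lowest⇒Nested M h (λ k p → closeCount-tail k r M (l k p))
  below : ∀ M → HeadDominated (r ∷ M) → Nested M → All (_⊑ r) M
  below []      _ _ = []
  below (A ∷ M) d (rj , sub , _) = A⊑r ∷ All.map (λ p → ⊑-trans p A⊑r) sub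
    where A⊑r = Dominated-RightJustified A r rj d
  sub : All (_⊑ r) M
  sub = below M d rest
  rj : RightJustified r
  rj k p q with getV r (suc k) in eq
  ... | true  = refl
  ... | false with l k p
  ...   | z rewrite q | eq | openCount-empty k M (All.map (λ s → getV-⊑ s (suc k) eq) sub) with () ← z

getV-ext : (u v : Subset n) → (∀ k → k < n → getV u k ≡ getV v k) → u ≡ v
getV-ext []      []      _ = refl
getV-ext (a ∷ u) (b ∷ v) h = cong₂ _∷_ (h 0 (s≤s z≤n)) (getV-ext u v (λ k p → h (suc k) (s≤s p)))

columnCount-empty : ∀ c (M : Config n) → All (λ r → getV r c ≡ false) M → columnCount c M ≡ 0
columnCount-empty c []      []       = refl
columnCount-empty c (r ∷ M) (e ∷ es) rewrite e = columnCount-empty c M es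

-- The bottom row contains all others, so it is the support of the column sums; it can be subtracted
-- and the argument repeated.
Nested-unique : (M N : Config n) → length M ≡ length N → Nested M → Nested N →
  (∀ c → columnCount c M ≡ columnCount c N) → M ≡ N
Nested-unique []      []      _ _ _ _ = refl
Nested-unique (r ∷ M) (s ∷ N) l (_ , p , nm) (_ , q , nn) h with bottoms
  where
  bottoms : r ≡ s
  bottoms = getV-ext r s (λ c _ → same c)
    where
    same : ∀ c → getV r c ≡ getV s c
    same c with getV r c in e | getV s c in f | h c
    ... | true  | true  | _ = refl
    ... | false | false | _ = refl
    ... | true  | false | g rewrite columnCount-empty c N (All.map (λ t → getV-⊑ t c f) q) with () ← g
    ... | false | true  | g rewrite columnCount-empty c M (All.map (λ t → getV-⊑ t c e) p) with () ← g
... | refl = cong (r ∷_) (Nested-unique M N (suc-injective l) nm nn (λ c → +-cancelˡ-≡ (bit (getV r c)) _ _ (h c)))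

-- The moves f→ commute with ↝ and are injective where they act, so M may be assumed
-- column-lowest; then N and N′ are right-justified and have the same column sums.
Nonwrapping-unique : {M N N′ : Config n} → M ↝ N → M ↝ N′ → Nonwrapping N → Nonwrapping N′ → N ≡ N′
Nonwrapping-unique {n} {M} p q h h′ = go (potential M) M refl p q h h′
  where
  go : ∀ m (M : Config n) {N N′ : Config n} → potential M ≡ m → M ↝ N → M ↝ N′ → Nonwrapping N → Nonwrapping N′ → N ≡ N′
  go m M {N} {N′} pm p q h h′ with anyUpTo? (λ k → 1 ≤? closeCount k M) (pred n)
  go m M {N} {N′} pm p q h h′ | no ¬a =
    Nested-unique N N′ (trans (length-↝ p) (sym (length-↝ q)))
      (Nonwrapping-Lowest⇒Nested N h (λ k k<n → trans (closeCount-↝ k k<n p) (lowest k k<n)))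
      (Nonwrapping-Lowest⇒Nested N′ h′ (λ k k<n → trans (closeCount-↝ k k<n q) (lowest k k<n)))
      (λ c → trans (columnCount-↝ c p) (sym (columnCount-↝ c q)))
    where
    lowest : Lowest M
    lowest k k<n = n<1⇒n≡0 (≰⇒> (λ c → ¬a (k , pred-mono-≤ k<n , c)))
  go m M {N} {N′} pm p q h h′ | yes (k , k<pred , c) = descend m pm
    where
    k<n : suc k < n
    k<n = <-≤-trans (s<s k<pred) (suc-pred≤ n k<pred)
      where
      suc-pred≤ : ∀ n → k < pred n → suc (pred n) ≤ n
      suc-pred≤ (suc n) _ = ≤-refl
    nonzero : closeCount k M ≢ 0
    nonzero z with () ← subst (1 ≤_) z c
    descend : ∀ m → potential M ≡ m → N ≡ N′
    descend zero    pm with () ← trans (potential-moveRight k k<n M nonzero) pm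
    descend (suc m) pm = moveRight-injective k k<n N N′
      (λ z → nonzero (trans (sym (closeCount-↝ k k<n p)) z)) (λ z → nonzero (trans (sym (closeCount-↝ k k<n q)) z))
      (go m (moveRight k M) (suc-injective (trans (potential-moveRight k k<n M nonzero) pm))
        (↝-moveRight k k<n p) (↝-moveRight k k<n q) (Nonwrapping-moveRight k k<n N h) (Nonwrapping-moveRight k k<n N′ h′))

-- Collapsing from the top

chain : Subset n → Config n → Config n
chain B []      = B ∷ []
chain B (A ∷ M) = low A B ∷ chain (up A B) M

-- `rhoN` takes in the rows from the bottom up. Here the bottom row enters last, in a single pass
-- through the collapsed upper rows, and it is this pass that `bottom-formula` inverts.
collapse : Config n → Config n
collapse []      = []
collapse (r ∷ M) = chain r (collapse M)

↝-chain : ∀ B (M : Config n) → B ∷ M ↝ chain B M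
↝-chain B []      = done
↝-chain B (A ∷ M) = step 0 (↝-cons (low A B) (↝-chain (up A B) M))

↝-collapse : (M : Config n) → M ↝ collapse M
↝-collapse []      = done
↝-collapse (r ∷ M) = ↝-trans (↝-cons r (↝-collapse M)) (↝-chain r (collapse M))

Nonwrapping-chain : ∀ B (M : Config n) → Nonwrapping M → Nonwrapping (chain B M)
Nonwrapping-chain B []          _       = tt , tt
Nonwrapping-chain B (A ∷ [])    _       = Dominated-up-low A B , tt , tt
Nonwrapping-chain B (A ∷ C ∷ M) (d , h) = Dominated-lower-raise B A C d , Nonwrapping-chain (up A B) (C ∷ M) h

Nonwrapping-collapse : (M : Config n) → Nonwrapping (collapse M)
Nonwrapping-collapse []      = tt
Nonwrapping-collapse (r ∷ M) = Nonwrapping-chain r (collapse M) (Nonwrapping-collapse M)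

collapse-unique : {M N : Config n} → M ↝ N → Nonwrapping N → collapse M ≡ N
collapse-unique {M = M} p h = Nonwrapping-unique (↝-collapse M) p (Nonwrapping-collapse M) h

collapse-↝ : {M N : Config n} → M ↝ N → collapse M ≡ collapse N
collapse-↝ {N = N} p = collapse-unique (↝-trans p (↝-collapse N)) (Nonwrapping-collapse N)

-- f→ carries the reduction of M to its collapse over to one that starts at the moved configuration
-- and again ends in a nonwrapping one.
collapse-moveRight : ∀ k → suc k < n → (M : Config n) → collapse (moveRight k M) ≡ moveRight k (collapse M)
collapse-moveRight k k<n M = collapse-unique (↝-moveRight k k<n (↝-collapse M)) (Nonwrapping-moveRight k k<n _ (Nonwrapping-collapse M))

-- Reflections of the two bottom rows

reflect : Config n → Config n
reflect (B ∷ A ∷ M) = occupied A B ∷ rise (opens A B) A B ∷ M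
reflect M           = M

lowerAll-reflect : (M : Config n) → lowerAll 0 (reflect M) ≡ lowerAll 0 M
lowerAll-reflect []          = refl
lowerAll-reflect (B ∷ [])    = refl
lowerAll-reflect (B ∷ A ∷ M) with collapse-reflect (opens A B) A B
... | e , f = cong₂ _∷_ f (cong (_∷ M) e)

collapse-reflected : (M : Config n) → collapse (reflect M) ≡ collapse M
collapse-reflected M = begin
  collapse (reflect M)         ≡⟨ collapse-↝ {M = reflect M} (step 0 done) ⟩
  collapse (lowerAll 0 (reflect M))  ≡⟨ cong collapse (lowerAll-reflect M) ⟩
  collapse (lowerAll 0 M)            ≡⟨ collapse-↝ {M = M} (step 0 done) ⟨
  collapse M                   ∎
  where open ≡-Reasoning

headCloses headOpens : Config n → ℕ
headCloses (B ∷ A ∷ _) = closes A B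
headCloses _           = 0
headOpens (B ∷ A ∷ _) = opens A B
headOpens _           = 0

head-moveRight : ∀ k → suc k < n → (M : Config n) → headCloses (moveRight k M) ≡ headCloses M × headOpens (moveRight k M) ≡ headOpens M
head-moveRight k k<n []          = refl , refl
head-moveRight k k<n (B ∷ [])    with eligibleAt k B []
... | true  = refl , refl
... | false = refl , refl
head-moveRight k k<n (B ∷ A ∷ M) rewrite moveRight-two k B A M =
  MovePair.same-closes k (openCount k M) 0 A B k<n , MovePair.same-opens k (openCount k M) 0 A B k<n

headCloses-reflect : (M : Config n) → headCloses (reflect M) ≡ headOpens M ⊓ headCloses M
headCloses-reflect []          = refl
headCloses-reflect (B ∷ [])    = refl
headCloses-reflect (B ∷ A ∷ M) = closes-reflect (opens A B) A B

-- The top of an e↓-string names the string and `headCloses` the position on it; `reflect-collapse`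
-- recovers the pair from both.
string-injective : (M N : Config n) → lowerAll 0 M ≡ lowerAll 0 N → headCloses M ≡ headCloses N → M ≡ N
string-injective []          []           e c = refl
string-injective []          (B ∷ [])     () c
string-injective []          (B ∷ A ∷ N)  () c
string-injective (B ∷ [])    []           () c
string-injective (B ∷ A ∷ M) []           () c
string-injective (B ∷ [])    (C ∷ [])     e c = e
string-injective (B ∷ [])    (C ∷ D ∷ N)  () c
string-injective (B ∷ A ∷ M) (C ∷ [])     () c
string-injective (B ∷ A ∷ M) (D ∷ C ∷ N) e c with ∷-injective e
... | l , e′ with ∷-injective e′
...   | u , refl = cong₂ (λ X Y → X ∷ Y ∷ M)
  (trans (sym (proj₂ (reflect-collapse A B))) (trans (cong₃ occupiedFrom c u l) (proj₂ (reflect-collapse C D))))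
  (trans (sym (proj₁ (reflect-collapse A B))) (trans (cong₃ rise c u l) (proj₁ (reflect-collapse C D))))
  where
  cong₃ : ∀ {X Y Z W : Set} (f : X → Y → Z → W) {x x′ y y′ z z′} → x ≡ x′ → y ≡ y′ → z ≡ z′ → f x y z ≡ f x′ y′ z′
  cong₃ f refl refl refl = refl

-- In these string coordinates little is left to compare: f→ commutes with passing to the top and
-- preserves `headOpens` and `headCloses`, whose minimum is the new position after reflection.
reflect-moveRight : ∀ k → suc k < n → (M : Config n) → reflect (moveRight k M) ≡ moveRight k (reflect M)
reflect-moveRight k k<n M = string-injective _ _
  (begin
    lowerAll 0 (reflect (moveRight k M))  ≡⟨ lowerAll-reflect (moveRight k M) ⟩
    lowerAll 0 (moveRight k M)            ≡⟨ moveRight-lowerAll k k<n 0 M ⟩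
    moveRight k (lowerAll 0 M)            ≡⟨ cong (moveRight k) (lowerAll-reflect M) ⟨
    moveRight k (lowerAll 0 (reflect M))  ≡⟨ moveRight-lowerAll k k<n 0 (reflect M) ⟨
    lowerAll 0 (moveRight k (reflect M))  ∎)
  (begin
    headCloses (reflect (moveRight k M))                ≡⟨ headCloses-reflect (moveRight k M) ⟩
    headOpens (moveRight k M) ⊓ headCloses (moveRight k M)     ≡⟨ cong₂ _⊓_ (proj₂ (head-moveRight k k<n M)) (proj₁ (head-moveRight k k<n M)) ⟩
    headOpens M ⊓ headCloses M                   ≡⟨ headCloses-reflect M ⟨
    headCloses (reflect M)                       ≡⟨ proj₁ (head-moveRight k k<n (reflect M)) ⟨
    headCloses (moveRight k (reflect M))                ∎)
  where open ≡-Reasoning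

openCount-reflect : ∀ k → suc k < n → (M : Config n) → openCount k (reflect M) ≡ openCount k M
openCount-reflect k k<n M = trans (sym (openCount-lowerAll k k<n 0 (reflect M))) (trans (cong (openCount k) (lowerAll-reflect M)) (openCount-lowerAll k k<n 0 M))

-- The row r notices the rows above it only through `openCount`, so an operator on those rows that
-- keeps this number leaves the choice at r unchanged.
cons-moveRight : ∀ k r (M : Config n) (g : Config n → Config n) → g (moveRight k M) ≡ moveRight k (g M) → openCount k (g M) ≡ openCount k M →
  moveIf (eligibleAt k r M) k r ∷ g (if eligibleAt k r M then M else moveRight k M) ≡ moveRight k (r ∷ g M)
cons-moveRight k r M g e c rewrite c with eligibleAt k r M
... | true  = refl
... | false = cong (moveIf false k r ∷_) e

-- Keys and row sizes

-- s₁ ⋯ sᵢ M, whose bottom row is the image of row i (counted from 0).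
bringDown : ℕ → Config n → Config n
bringDown zero    M       = M
bringDown (suc i) []      = []
bringDown (suc i) (r ∷ M) = reflect (r ∷ bringDown i M)

openCount-bringDown : ∀ k → suc k < n → ∀ i (M : Config n) → openCount k (bringDown i M) ≡ openCount k M
openCount-bringDown k k<n zero    M       = refl
openCount-bringDown k k<n (suc i) []      = refl
openCount-bringDown k k<n (suc i) (r ∷ M) = trans (openCount-reflect k k<n (r ∷ bringDown i M)) (cong (closeSite (getV r k) (getV r (suc k))) (openCount-bringDown k k<n i M))

bringDown-moveRight : ∀ k → suc k < n → ∀ i (M : Config n) → bringDown i (moveRight k M) ≡ moveRight k (bringDown i M)
bringDown-moveRight k k<n zero    M       = refl
bringDown-moveRight k k<n (suc i) []      = refl
bringDown-moveRight k k<n (suc i) (r ∷ M) = trans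
  (cong reflect (cons-moveRight k r M (bringDown i) (bringDown-moveRight k k<n i M) (openCount-bringDown k k<n i M))) (reflect-moveRight k k<n (r ∷ bringDown i M))

collapse-bringDown : ∀ i (M : Config n) → collapse (bringDown i M) ≡ collapse M
collapse-bringDown zero    M       = refl
collapse-bringDown (suc i) []      = refl
collapse-bringDown (suc i) (r ∷ M) = trans (collapse-reflected (r ∷ bringDown i M)) (cong (chain r) (collapse-bringDown i M))

-- For decreasing row sizes, entry i (from 0) is the set of sites of row 1 whose FM label exceeds i;
-- see `typeOf-keys`.
keys : Config n → List (Subset n)
keys []      = []
keys (r ∷ M) = r ∷ map (λ S → occupied S r) (keys M)

-- Out of range, the empty row.
at : ℕ → List (Subset n) → Subset n
at i       []      = ∅
at zero    (S ∷ K) = S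
at (suc i) (S ∷ K) = at i K

at-map-occupied : ∀ i (K : List (Subset n)) r → at i (map (λ S → occupied S r) K) ≡ occupied (at i K) r
at-map-occupied i       []      r = sym (occupied-∅ r)
at-map-occupied zero    (S ∷ K) r = refl
at-map-occupied (suc i) (S ∷ K) r = at-map-occupied i K r

length-reflect : (M : Config n) → length (reflect M) ≡ length M
length-reflect []          = refl
length-reflect (B ∷ [])    = refl
length-reflect (B ∷ A ∷ M) = refl

length-bringDown : ∀ i (M : Config n) → length (bringDown i M) ≡ length M
length-bringDown zero    M       = refl
length-bringDown (suc i) []      = refl
length-bringDown (suc i) (r ∷ M) = trans (length-reflect (r ∷ bringDown i M)) (cong suc (length-bringDown i M))

at-keys : ∀ i (M : Config n) → i < length M → at i (keys M) ≡ at 0 (bringDown i M)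
at-keys zero    (r ∷ M) _       = refl
at-keys (suc i) (r ∷ M) (s≤s p) = trans (at-map-occupied i (keys M) r) (trans (cong (λ S → occupied S r) (at-keys i M p)) (top (bringDown i M) (subst (i <_) (sym (length-bringDown i M)) p)))
  where
  top : ∀ N → i < length N → occupied (at 0 N) r ≡ at 0 (reflect (r ∷ N))
  top (A ∷ N) _ = refl

-- These are the sizes of the rows that `chain` carries upwards. The last carried row is placed
-- unchanged and its size is not recorded, in agreement with the case `[]` of `rebuild`.
sizes : Subset n → Config n → List ℕ
sizes B []      = []
sizes B (A ∷ M) = ∣ B ∣ ∷ sizes (up A B) M

sizes′ : Config n → List ℕ
sizes′ []      = []
sizes′ (r ∷ M) = sizes r M

∣moveIf∣ : ∀ k c (r : Subset n) → suc k < n → ∣ moveIf (eligible (getV r k) (getV r (suc k)) c) k r ∣ ≡ ∣ r ∣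
∣moveIf∣ zero    zero    (true ∷ false ∷ r)  _       = refl
∣moveIf∣ zero    (suc c) (true ∷ false ∷ r)  _       = refl
∣moveIf∣ zero    c       (true ∷ true ∷ r)   _       = refl
∣moveIf∣ zero    c       (false ∷ a ∷ r)     _       = refl
∣moveIf∣ zero    c       (_ ∷ [])            (s≤s ())
∣moveIf∣ (suc k) c       (true ∷ r)          (s≤s p) = cong suc (∣moveIf∣ k c r p)
∣moveIf∣ (suc k) c       (false ∷ r)         (s≤s p) = ∣moveIf∣ k c r p

-- Above its first row, `lowerAll 0` contains the row carried on. Since it commutes with f→, the
-- claim for the remaining rows applies to its tail.
sizes-moveRight : ∀ k → suc k < n → ∀ B (M : Config n) → sizes′ (moveRight k (B ∷ M)) ≡ sizes B M
sizes-moveRight k k<n B [] with eligibleAt k B []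
... | true  = refl
... | false = refl
sizes-moveRight k k<n B (A ∷ M) = trans split (cong₂ _∷_ (∣moveIf∣ k (openCount k (A ∷ M)) B k<n)
  (trans (cong (λ N → sizes′ (drop 1 N)) (moveRight-lowerAll k k<n 0 (B ∷ A ∷ M))) rest))
  where
  split : sizes′ (moveRight k (B ∷ A ∷ M)) ≡
    ∣ moveIf (eligibleAt k B (A ∷ M)) k B ∣ ∷ sizes′ (drop 1 (lowerAll 0 (moveRight k (B ∷ A ∷ M))))
  split with eligibleAt k B (A ∷ M)
  ... | true  = refl
  ... | false = refl
  rest : sizes′ (drop 1 (moveRight k (low A B ∷ up A B ∷ M))) ≡ sizes (up A B) M
  rest with eligibleAt k (low A B) (up A B ∷ M)
  ... | true  = refl
  ... | false = sizes-moveRight k k<n (up A B) M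

-- Rebuilding a bottom row from keys and sizes

-- The sizes met while collapsing M when its upper rows are collapsed first.
profile : Config n → List ℕ
profile []      = []
profile (r ∷ M) = sizes r (collapse M)

profile-moveRight : ∀ k → suc k < n → (M : Config n) → profile (moveRight k M) ≡ profile M
profile-moveRight k k<n []      = refl
profile-moveRight k k<n (r ∷ M) = trans
  (cong sizes′ (cons-moveRight k r M collapse (collapse-moveRight k k<n M) (openCount-↝ k k<n (↝-collapse M)))) (sizes-moveRight k k<n r (collapse M))

-- This inverts `chain`. The first key S is the new lower row, the recursive value is the carried
-- row as parked in S, and t is the size of the row sought; their difference is the number of
-- unmatched closing brackets to restore.
rebuild : List ℕ → List (Subset n) → Subset n
rebuild ts       []      = ∅
rebuild []       (S ∷ K) = S
rebuild (t ∷ ts) (S ∷ K) = fill (t ∸ ∣ rebuild ts K ∣) S (rebuild ts K)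

Flag : List (Subset n) → Set
Flag []      = ⊤
Flag (S ∷ K) = All (_⊑ S) K × Flag K

∅⊑ : (S : Subset n) → ∅ ⊑ S
∅⊑ []      = []
∅⊑ (s ∷ S) = skip (∅⊑ S)

fill⊑ : ∀ m {U S : Subset n} → U ⊑ S → fill m S U ⊑ S
fill⊑ m       []                   = []
fill⊑ m       (both p)             = both (fill⊑ m p)
fill⊑ m       (skip {s = false} p) = skip (fill⊑ m p)
fill⊑ zero    (skip {s = true} p)  = skip (fill⊑ 0 p)
fill⊑ (suc m) (skip {s = true} p)  = both (fill⊑ m p)

rebuild⊑ : ∀ ts {S : Subset n} {K} → All (_⊑ S) K → Flag K → rebuild ts K ⊑ S
rebuild⊑ ts       []      _        = ∅⊑ _
rebuild⊑ []       (p ∷ _) _        = p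
rebuild⊑ (t ∷ ts) (p ∷ _) (q , f)  = ⊑-trans (fill⊑ _ (rebuild⊑ ts q f)) p

⊑⇒≤ : {U S : Subset n} → U ⊑ S → ∣ U ∣ ≤ ∣ S ∣
⊑⇒≤ []                   = z≤n
⊑⇒≤ (skip {s = true} p)  = m≤n⇒m≤1+n (⊑⇒≤ p)
⊑⇒≤ (skip {s = false} p) = ⊑⇒≤ p
⊑⇒≤ (both p)             = s≤s (⊑⇒≤ p)

Dominated-⊑ : {U S : Subset n} → U ⊑ S → ∀ r → Dominated S r → Dominated U r
Dominated-⊑ []         []      _       = tt
Dominated-⊑ p@(skip q) (_ ∷ r) (l , d) = ≤-trans (⊑⇒≤ p) l , Dominated-⊑ q r d
Dominated-⊑ p@(both q) (_ ∷ r) (l , d) = ≤-trans (⊑⇒≤ p) l , Dominated-⊑ q r d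

occupied-Dominated : (A B : Subset n) → Dominated A B → occupied A B ≡ occupiedFrom 0 A B
occupied-Dominated A B d = cong (λ c → occupiedFrom c A B) (Dominated⇒opens≡0 A B d)

∣occupied∣ : (A B : Subset n) → Dominated A B → ∣ occupied A B ∣ ≡ ∣ A ∣
∣occupied∣ A B d = trans (cong ∣_∣ (occupied-Dominated A B d)) (trans (cong (_+ ∣ occupiedFrom 0 A B ∣) (sym carryOut≡0)) (carryOut-∣occupiedFrom∣ 0 A B))
  where
  carryOut≡0 : carryOut 0 A B ≡ 0
  carryOut≡0 = trans (carryOut-opens 0 A B) (cong₂ _+_ (Dominated⇒opens≡0 A B d) (0∸n≡0 (closes A B)))

-- All sets involved are contained in keys dominated by r, so nothing wraps when they are parked in
-- r: every scan starts with no waiting car, sizes are kept, and `fill-occupiedFrom` applies with x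
-- = c = 0.
rebuild-occupied : ∀ ts (K : List (Subset n)) r → Flag K → All (λ S → Dominated S r) K →
  rebuild ts (map (λ S → occupied S r) K) ≡ occupied (rebuild ts K) r
rebuild-occupied ts       []      r _       _       = sym (occupied-∅ r)
rebuild-occupied []       (S ∷ K) r _       _       = refl
rebuild-occupied (t ∷ ts) (S ∷ K) r (p , f) (d ∷ ds) rewrite rebuild-occupied ts K r f ds = begin
  fill (t ∸ ∣ occupied U r ∣) (occupied S r) (occupied U r)  ≡⟨ cong (λ m → fill (t ∸ m) (occupied S r) (occupied U r)) (∣occupied∣ U r dU) ⟩
  fill m (occupied S r) (occupied U r)                  ≡⟨ cong₂ (fill m) (occupied-Dominated S r d) (occupied-Dominated U r dU) ⟩
  fill m (occupiedFrom 0 S r) (occupiedFrom 0 U r)              ≡⟨ cong (λ m → fill m (occupiedFrom 0 S r) (occupiedFrom 0 U r)) (+-identityʳ m) ⟨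
  fill (m + 0) (occupiedFrom 0 S r) (occupiedFrom 0 U r)        ≡⟨ fill-occupiedFrom m 0 0 r U⊑S ⟩
  occupiedFrom 0 (fill m S U) r                        ≡⟨ occupied-Dominated (fill m S U) r (Dominated-⊑ (fill⊑ m U⊑S) r d) ⟨
  occupied (fill m S U) r                          ∎
  where
  open ≡-Reasoning
  U = rebuild ts K
  m = t ∸ ∣ U ∣
  U⊑S : U ⊑ S
  U⊑S = rebuild⊑ ts p f
  dU : Dominated U r
  dU = Dominated-⊑ U⊑S r d

occupiedFrom-mono : ∀ {c c′} {U S : Subset n} r → c ≤ c′ → U ⊑ S → occupiedFrom c U r ⊑ occupiedFrom c′ S r
occupiedFrom-mono [] p [] = []
occupiedFrom-mono (false ∷ r) p (both q) = skip (occupiedFrom-mono r (s≤s p) q)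
occupiedFrom-mono (true ∷ r)  p (both q) = both (occupiedFrom-mono r p q)
occupiedFrom-mono (false ∷ r) p (skip {s = true} q) = skip (occupiedFrom-mono r (m≤n⇒m≤1+n p) q)
occupiedFrom-mono (false ∷ r) p (skip {s = false} q) = skip (occupiedFrom-mono r p q)
occupiedFrom-mono {c = zero}  (true ∷ r) p       (skip {s = true} q)  = skip (occupiedFrom-mono r z≤n q)
occupiedFrom-mono {c = suc c} (true ∷ r) p       (skip {s = true} q)  = both (occupiedFrom-mono r (≤-trans (n≤1+n c) p) q)
occupiedFrom-mono {c = zero}  (true ∷ r) p       (skip {s = false} q) = skip (occupiedFrom-mono r z≤n q)
occupiedFrom-mono {c = suc c} (true ∷ r) (s≤s p) (skip {s = false} q) = both (occupiedFrom-mono r p q)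

keys⊑ : (M : Config n) → All (_⊑ at 0 M) (keys M)
keys⊑ []      = []
keys⊑ (r ∷ M) = ⊑-refl r ∷ go (keys M)
  where
  go : ∀ K → All (_⊑ r) (map (λ S → occupied S r) K)
  go []      = []
  go (S ∷ K) = occupiedFrom⊑ _ S r ∷ go K

keys-Dominated : ∀ r (M : Config n) → HeadDominated (r ∷ M) → All (λ S → Dominated S r) (keys M)
keys-Dominated r []      _ = []
keys-Dominated r (A ∷ M) d = All.map (λ p → Dominated-⊑ p r d) (keys⊑ (A ∷ M))

keys-Flag : (M : Config n) → Nonwrapping M → Flag (keys M)
keys-Flag []      _       = tt
keys-Flag (r ∷ M) (d , h) = All.tail (keys⊑ (r ∷ M)) , go (keys M) (keys-Flag M h) (keys-Dominated r M d)
  where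
  go : ∀ K → Flag K → All (λ S → Dominated S r) K → Flag (map (λ S → occupied S r) K)
  go []      _       _        = tt
  go (S ∷ K) (p , f) (d ∷ ds) = mono p ds , go K f ds
    where
    mono : ∀ {K} → All (_⊑ S) K → All (λ S → Dominated S r) K → All (_⊑ occupied S r) (map (λ S → occupied S r) K)
    mono []      []        = []
    mono (_∷_ {U} q qs) (e ∷ es) = subst₂ _⊑_ (sym (occupied-Dominated U r e)) (sym (occupied-Dominated S r d)) (occupiedFrom-mono r z≤n q) ∷ mono qs es

-- Induction yields the carried row `u` from the keys of the shorter chain. The keys at hand are
-- those keys parked in `l`, so rebuilding from them yields `u` parked in `l`, and `fill-low`
-- returns B.
bottom-formula : ∀ B (M : Config n) → Nonwrapping M → B ≡ rebuild (sizes B M) (keys (chain B M))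
bottom-formula B []      _       = refl
bottom-formula B (A ∷ M) h′@(_ , h) = sym (begin
  fill (∣ B ∣ ∸ ∣ rebuild ts (map (λ S → occupied S l) K) ∣) l (rebuild ts (map (λ S → occupied S l) K))
    ≡⟨ cong (λ U → fill (∣ B ∣ ∸ ∣ U ∣) l U) (trans (rebuild-occupied ts K l (keys-Flag _ (proj₂ hw)) (keys-Dominated l _ (proj₁ hw))) (cong (λ S → occupied S l) (sym (bottom-formula u M h)))) ⟩
  fill (∣ B ∣ ∸ ∣ occupied u l ∣) l (occupied u l)
    ≡⟨ cong₂ (λ m U → fill (∣ B ∣ ∸ m) l U) (∣occupied∣ u l (Dominated-up-low A B)) (occupied-Dominated u l (Dominated-up-low A B)) ⟩
  fill (∣ B ∣ ∸ ∣ u ∣) l (occupiedFrom 0 u l)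
    -- The number of balls to add is the number of unmatched closing brackets, because `up A B` has
    -- as many balls as there are matched ones.
    ≡⟨ cong (λ m → fill m l (occupiedFrom 0 u l)) (trans (cong (_∸ ∣ u ∣) (sym (∣up∣+closes A B))) (m+n∸m≡n ∣ u ∣ (closes A B))) ⟩
  fill (closes A B) l (occupiedFrom 0 u l)
    ≡⟨ fill-low 0 A B z≤n ⟩
  B ∎)
  where
  open ≡-Reasoning
  u = up A B
  l = low A B
  ts = sizes u M
  K = keys (chain u M)
  hw = Nonwrapping-chain B (A ∷ M) h′

-- Key i is the bottom row of `bringDown i M`, to which `bottom-formula` applies; the reflections
-- have not changed the collapse.
key-formula : ∀ i (M : Config n) → i < length M → at i (keys M) ≡ rebuild (profile (bringDown i M)) (keys (collapse M))
key-formula i M p = trans (at-keys i M p) (trans (go (bringDown i M) (subst (i <_) (sym (length-bringDown i M)) p))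
  (cong (λ N → rebuild (profile (bringDown i M)) (keys N)) (collapse-bringDown i M)))
  where
  go : ∀ N → i < length N → at 0 N ≡ rebuild (profile N) (keys (collapse N))
  go (r ∷ N) _ = bottom-formula r (collapse N) (Nonwrapping-collapse N)

-- Row words and f→

-- The local function go of unmatched has no name outside Defs; the unification
-- problem in go-spec, where its arguments have become variables, solves for it.
mutual
  go : {T : Set} → ℕ → List T → List T → List (T × ℕ) → List T × List T
  go {T} = _

  go-spec : {T : Set} (i : ℕ) (t : T) (a : ℕ) (w : List (T × ℕ)) → (a ≡ᵇ i) ≡ false → (a ≡ᵇ suc i) ≡ true →
    unmatched i ((t , a) ∷ w) ≡ go i (t ∷ []) [] w
  go-spec {T} i t a w p q rewrite p | q with (List T ∋ t ∷ [])
  ... | st with (List T ∋ [])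
  ...   | cl = refl

State : Set → Set
State T = List T × List T

close : {T : Set} → T → State T → State T
close t ([] , cl)     = [] , t ∷ cl
close t (_ ∷ st , cl) = st , cl

push : {T : Set} → T → State T → State T
push t (st , cl) = t ∷ st , cl

letter : {T : Set} → ℕ → State T → T × ℕ → State T
letter i s (t , a) = if a ≡ᵇ i then close t s else if a ≡ᵇ suc i then push t s else s

go-foldl : {T : Set} (i : ℕ) (st cl : List T) (w : List (T × ℕ)) →
  go i st cl w ≡ (reverse (proj₂ (foldl (letter i) (st , cl) w)) , reverse (proj₁ (foldl (letter i) (st , cl) w)))
go-foldl i st cl [] = refl
go-foldl i st cl ((t , a) ∷ w) with a ≡ᵇ i | a ≡ᵇ suc i
go-foldl i []       cl ((t , a) ∷ w) | true  | _     = go-foldl i [] (t ∷ cl) w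
go-foldl i (_ ∷ st) cl ((t , a) ∷ w) | true  | _     = go-foldl i st cl w
go-foldl i st       cl ((t , a) ∷ w) | false | true  = go-foldl i (t ∷ st) cl w
go-foldl i st       cl ((t , a) ∷ w) | false | false = go-foldl i st cl w

unmatched-foldl : {T : Set} (i : ℕ) (w : List (T × ℕ)) →
  unmatched i w ≡ (reverse (proj₂ (foldl (letter i) ([] , []) w)) , reverse (proj₁ (foldl (letter i) ([] , []) w)))
unmatched-foldl i w = go-foldl i [] [] w

last-∷ʳ : {T : Set} (xs : List T) (x : T) → last (xs ∷ʳ x) ≡ just x
last-∷ʳ []           x = refl
last-∷ʳ (y ∷ [])     x = refl
last-∷ʳ (y ∷ z ∷ xs) x = last-∷ʳ (z ∷ xs) x

last-reverse : {T : Set} (xs : List T) → last (reverse xs) ≡ head xs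
last-reverse []       = refl
last-reverse (x ∷ xs) = trans (cong last (unfold-reverse x xs)) (last-∷ʳ (reverse xs) x)

head-reverse : {T : Set} (xs : List T) → head (reverse xs) ≡ last xs
head-reverse xs = trans (sym (last-reverse (reverse xs))) (cong last (reverse-involutive xs))

≡ᵇ-refl : ∀ m → (m ≡ᵇ m) ≡ true
≡ᵇ-refl zero    = refl
≡ᵇ-refl (suc m) = ≡ᵇ-refl m

<⇒≡ᵇ : ∀ {m n} → m < n → (m ≡ᵇ n) ≡ false
<⇒≡ᵇ {zero}  (s≤s _) = refl
<⇒≡ᵇ {suc m} (s≤s p) = <⇒≡ᵇ p

>⇒≡ᵇ : ∀ {m n} → m < n → (n ≡ᵇ m) ≡ false
>⇒≡ᵇ {zero}  (s≤s _) = refl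
>⇒≡ᵇ {suc m} (s≤s p) = >⇒≡ᵇ p

Tag : Set
Tag = ℕ × ℕ

rowWord : ℕ → Subset n → List ℕ → List (Tag × ℕ)
rowWord i r cs = map (λ c → (i , c) , suc c) (keep (getV r) cs)

rowStep : ℕ → ℕ → Subset n → State Tag → State Tag
rowStep k i r s = lower′ (if getV r (suc k) then push (i , suc k) s else s)
  where
  lower′ : State Tag → State Tag
  lower′ s = if getV r k then close (i , k) s else s

read-below : ∀ k i (r : Subset n) m s → m ≤ k → foldl (letter (suc k)) s (rowWord i r (downFrom m)) ≡ s
read-below k i r zero    s _ = refl
read-below k i r (suc m) s p with getV r m
... | false = read-below k i r m s (≤-trans (n≤1+n m) p)
... | true rewrite <⇒≡ᵇ p | <⇒≡ᵇ (m≤n⇒m≤1+n p) = read-below k i r m s (≤-trans (n≤1+n m) p)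

-- The width is written `e + suc (suc k)` so that the `e` columns to the right of column k + 1, read
-- first, can be removed one by one.
read-row : ∀ k i (r : Subset n) e s → foldl (letter (suc k)) s (rowWord i r (downFrom (e + suc (suc k)))) ≡ rowStep k i r s
read-row k i r zero s with getV r (suc k) | getV r k
... | false | false = read-below k i r k _ ≤-refl
... | false | true rewrite ≡ᵇ-refl k = read-below k i r k _ ≤-refl
... | true  | false rewrite >⇒≡ᵇ (n<1+n k) | ≡ᵇ-refl k = read-below k i r k _ ≤-refl
... | true  | true rewrite >⇒≡ᵇ (n<1+n k) | ≡ᵇ-refl k = read-below k i r k _ ≤-refl
read-row k i r (suc e) s with getV r (e + suc (suc k))
... | false = read-row k i r e s
... | true rewrite >⇒≡ᵇ {k} {e + suc (suc k)} (≤-trans (n≤1+n _) (m≤n+m _ e)) | >⇒≡ᵇ {suc k} {e + suc (suc k)} (m≤n+m _ e) = read-row k i r e s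

rowsState : ℕ → (ℕ → ℕ) → Config n → State Tag
rowsState k g []      = [] , []
rowsState k g (r ∷ M) = rowStep k (g 0) r (rowsState k (g ∘ suc) M)

read-rw : ∀ k → suc k < n → (M : Config n) → foldl (letter (suc k)) ([] , []) (rw M) ≡ rowsState k id M
read-rw {n} k k<n M = go′ id M
  where
  f : ℕ × Subset n → List (Tag × ℕ)
  f = λ rrow → map (λ c → ((proj₁ rrow , c) , suc c)) (keep (getV (proj₂ rrow)) (reverse (upTo n)))
  row : ∀ i r s → foldl (letter (suc k)) s (f (i , r)) ≡ rowStep k i r s
  row i r s rewrite reverse-upTo n = subst (λ m → foldl (letter (suc k)) s (rowWord i r (downFrom m)) ≡ rowStep k i r s)
    (m∸n+n≡m k<n) (read-row k i r (n ∸ suc (suc k)) s)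
  go′ : ∀ g M → foldl (letter (suc k)) ([] , []) (concatMap f (reverse (zip (applyUpTo g (length M)) M))) ≡ rowsState k g M
  go′ g []      = refl
  go′ g (r ∷ M) = begin
    foldl (letter (suc k)) ([] , []) (concatMap f (reverse ((g 0 , r) ∷ z)))
      ≡⟨ cong (foldl (letter (suc k)) ([] , [])) (trans (cong (concatMap f) (unfold-reverse (g 0 , r) z)) (concatMap-++ f (reverse z) _)) ⟩
    foldl (letter (suc k)) ([] , []) (concatMap f (reverse z) ++ (f (g 0 , r) ++ []))
      ≡⟨ foldl-++ (letter (suc k)) _ (concatMap f (reverse z)) _ ⟩
    foldl (letter (suc k)) (foldl (letter (suc k)) ([] , []) (concatMap f (reverse z))) (f (g 0 , r) ++ [])
      ≡⟨ cong₂ (foldl (letter (suc k))) (go′ (g ∘ suc) M) (++-identityʳ (f (g 0 , r))) ⟩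
    foldl (letter (suc k)) (rowsState k (g ∘ suc) M) (f (g 0 , r))
      ≡⟨ row (g 0) r _ ⟩
    rowStep k (g 0) r (rowsState k (g ∘ suc) M) ∎
    where
    open ≡-Reasoning
    z = zip (applyUpTo (g ∘ suc) (length M)) M

Located : ℕ → (ℕ → ℕ) → Config n → Maybe Tag → Set
Located k g M nothing        = moveRight k M ≡ M
Located k g M (just (i , c)) = c ≡ k × ∃ λ r → i ≡ g r × moveRight k M ≡ updRow M r (λ row → setV (setV row k false) (suc k) true)

moveIf-true : ∀ k (r : Subset n) → suc k < n → moveIf true k r ≡ setV (setV r k false) (suc k) true
moveIf-true zero    (_ ∷ _ ∷ _) _       = refl
moveIf-true zero    (_ ∷ [])    (s≤s ())
moveIf-true (suc k) (a ∷ r)     (s≤s p) = cong (a ∷_) (moveIf-true k r p)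

Located-cons : ∀ k g r (M : Config n) m → eligibleAt k r M ≡ false → Located k (g ∘ suc) M m → Located k g (r ∷ M) m
Located-cons k g r M nothing        e l = trans (cong (λ b → moveIf b k r ∷ (if b then M else moveRight k M)) e) (cong₂ _∷_ (moveIf-false k r) l)
Located-cons k g r M (just (i , c)) e (c≡ , x , i≡ , l) =
  c≡ , suc x , i≡ , trans (cong (λ b → moveIf b k r ∷ (if b then M else moveRight k M)) e) (cong₂ _∷_ (moveIf-false k r) l)

-- The stack of waiting brackets has the height that `openCount` predicts. The bracket left
-- unmatched most recently is the last in the word, which `moveRight` meets first from the bottom.
locate : ∀ k → suc k < n → ∀ g (M : Config n) →
  length (proj₁ (rowsState k g M)) ≡ openCount k M × Located k g M (head (proj₂ (rowsState k g M)))
locate k k<n g [] = refl , refl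
locate k k<n g (r ∷ M) with getV r (suc k) in p | getV r k in q | rowsState k (g ∘ suc) M | locate k k<n (g ∘ suc) M
... | true | true | st , cl | l , h = l , Located-cons k g r M (head cl) not-eligible h
  where
  not-eligible : eligibleAt k r M ≡ false
  not-eligible rewrite p | q = refl
... | true | false | st , cl | l , h = cong suc l , Located-cons k g r M (head cl) not-eligible h
  where
  not-eligible : eligibleAt k r M ≡ false
  not-eligible rewrite p | q = refl
... | false | false | st , cl | l , h = l , Located-cons k g r M (head cl) not-eligible h
  where
  not-eligible : eligibleAt k r M ≡ false
  not-eligible rewrite p | q = refl
... | false | true | _ ∷ st , cl | l , h = cong pred l , Located-cons k g r M (head cl) not-eligible h
  where
  not-eligible : eligibleAt k r M ≡ false
  not-eligible rewrite p | q | sym l = refl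
... | false | true | [] , cl | l , h = cong pred l , refl , 0 , refl , moved
  where
  moved : moveRight k (r ∷ M) ≡ setV (setV r k false) (suc k) true ∷ M
  moved rewrite p | q | sym l = cong (_∷ M) (moveIf-true k r k<n)

fOp-moveRight : ∀ k → suc k < n → (M : Config n) → fOp (suc k) M ≡ moveRight k M
fOp-moveRight k k<n M with last (proj₁ (unmatched (suc k) (rw M))) | found
  where
  found : Located k id M (last (proj₁ (unmatched (suc k) (rw M))))
  found = subst (Located k id M) (sym (begin
    last (proj₁ (unmatched (suc k) (rw M)))      ≡⟨ cong (last ∘ proj₁) (unmatched-foldl (suc k) (rw M)) ⟩
    last (reverse (proj₂ (foldl (letter (suc k)) ([] , []) (rw M))))  ≡⟨ last-reverse (proj₂ (foldl (letter (suc k)) ([] , []) (rw M))) ⟩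
    head (proj₂ (foldl (letter (suc k)) ([] , []) (rw M)))   ≡⟨ cong (head ∘ proj₂) (read-rw k k<n M) ⟩
    head (proj₂ (rowsState k id M))   ∎)) (proj₂ (locate k k<n id M))
    where open ≡-Reasoning
... | nothing      | e = sym e
... | just (i , c) | refl , .i , refl , e = sym e

-- Column words and e↓

siteStep : ℕ → ℕ → Bool → Bool → State Tag → State Tag
siteStep j c a b s = lower′ (if a then push (suc j , c) s else s)
  where
  lower′ : State Tag → State Tag
  lower′ s = if b then close (j , c) s else s

readRows : ℕ → ℕ → (ℕ → ℕ) → Config n → State Tag → State Tag
readRows j c g M s = foldl (letter (suc j)) s
  (map (λ rrow → ((proj₁ rrow , c) , suc (proj₁ rrow)))
    (keep (λ rrow → getV (proj₂ rrow) c) (reverse (zip (applyUpTo g (length M)) M))))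

keep-++ : {A : Set} (p : A → Bool) (xs ys : List A) → keep p (xs ++ ys) ≡ keep p xs ++ keep p ys
keep-++ p []       ys = refl
keep-++ p (x ∷ xs) ys with p x
... | true  = cong (x ∷_) (keep-++ p xs ys)
... | false = keep-++ p xs ys

readRows-cons : ∀ j c g r (M : Config n) s → readRows j c g (r ∷ M) s ≡
  (if getV r c then letter (suc j) (readRows j c (g ∘ suc) M s) ((g 0 , c) , suc (g 0)) else readRows j c (g ∘ suc) M s)
readRows-cons {n} j c g r M s
  rewrite unfold-reverse (g 0 , r) (zip (applyUpTo (g ∘ suc) (length M)) M)
  | keep-++ (λ (rrow : ℕ × Subset n) → getV (proj₂ rrow) c) (reverse (zip (applyUpTo (g ∘ suc) (length M)) M)) ((g 0 , r) ∷ [])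
  | map-++ {B = Tag × ℕ} (λ (rrow : ℕ × Subset n) → ((proj₁ rrow , c) , suc (proj₁ rrow)))
      (keep (λ (rrow : ℕ × Subset n) → getV (proj₂ rrow) c) (reverse (zip (applyUpTo (g ∘ suc) (length M)) M)))
      (keep (λ (rrow : ℕ × Subset n) → getV (proj₂ rrow) c) ((g 0 , r) ∷ []))
  | foldl-++ (letter (suc j)) s
      (map (λ (rrow : ℕ × Subset n) → ((proj₁ rrow , c) , suc (proj₁ rrow)))
        (keep (λ (rrow : ℕ × Subset n) → getV (proj₂ rrow) c) (reverse (zip (applyUpTo (g ∘ suc) (length M)) M))))
      (map (λ (rrow : ℕ × Subset n) → ((proj₁ rrow , c) , suc (proj₁ rrow)))
        (keep (λ (rrow : ℕ × Subset n) → getV (proj₂ rrow) c) ((g 0 , r) ∷ [])))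
  with getV r c
... | true  = refl
... | false = refl

Consecutive : (ℕ → ℕ) → Set
Consecutive g = ∀ i → g (suc i) ≡ suc (g i)

Consecutive⇒< : ∀ g → Consecutive g → ∀ i → g 0 < g (suc i)
Consecutive⇒< g h zero    = ≤-reflexive (sym (h 0))
Consecutive⇒< g h (suc i) = ≤-trans (m≤n⇒m≤1+n (Consecutive⇒< g h i)) (≤-reflexive (sym (h (suc i))))

getV-∅ : ∀ n c → getV (∅ {n}) c ≡ false
getV-∅ zero    c       = refl
getV-∅ (suc n) zero    = refl
getV-∅ (suc n) (suc c) = getV-∅ n c

readRows-above : ∀ j c g (M : Config n) s → Consecutive g → suc j < g 0 → readRows j c g M s ≡ s
readRows-above j c g []      s h p = refl
readRows-above j c g (r ∷ M) s h p rewrite readRows-cons j c g r M s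
  | readRows-above j c (g ∘ suc) M s (h ∘ suc) (subst (suc j <_) (sym (h 0)) (m≤n⇒m≤1+n p)) with getV r c
... | false = refl
... | true rewrite >⇒≡ᵇ {suc j} {g 0} p | >⇒≡ᵇ {j} {g 0} (≤-trans (n≤1+n _) p) = refl

readRows-upper : ∀ j c g (M : Config n) s → Consecutive g → g 0 ≡ suc j →
  readRows j c g M s ≡ (if getV (at 0 M) c then push (suc j , c) s else s)
readRows-upper {n} j c g [] s h e rewrite getV-∅ n c = refl
readRows-upper j c g (r ∷ M) s h e rewrite readRows-cons j c g r M s
  | readRows-above j c (g ∘ suc) M s (h ∘ suc) (subst (suc j <_) (sym (trans (h 0) (cong suc e))) (n<1+n _)) with getV r c
... | false = refl
... | true rewrite e | >⇒≡ᵇ (n<1+n j) | ≡ᵇ-refl j = refl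

readRows-pair : ∀ j c g (M : Config n) i s → Consecutive g → g i ≡ j →
  readRows j c g M s ≡ siteStep j c (getV (at (suc i) M) c) (getV (at i M) c) s
readRows-pair {n} j c g [] i s h e rewrite getV-∅ n c = refl
readRows-pair j c g (r ∷ M) zero s h e rewrite readRows-cons j c g r M s
  | readRows-upper j c (g ∘ suc) M s (h ∘ suc) (trans (h 0) (cong suc e)) with getV r c
... | false = refl
... | true rewrite e | ≡ᵇ-refl j = refl
readRows-pair j c g (r ∷ M) (suc i) s h e rewrite readRows-cons j c g r M s
  | readRows-pair j c (g ∘ suc) M i s (h ∘ suc) e with getV r c
... | false = refl
... | true rewrite <⇒≡ᵇ (subst (g 0 <_) e (Consecutive⇒< g h i)) | <⇒≡ᵇ (m≤n⇒m≤1+n (subst (g 0 <_) e (Consecutive⇒< g h i))) = refl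

readColumns : ℕ → (ℕ → ℕ) → Subset n → Subset n → State Tag → State Tag
readColumns j h []      []      s = s
readColumns j h (a ∷ A) (b ∷ B) s = readColumns j (h ∘ suc) A B (siteStep j (h 0) a b s)

read-cw : ∀ j (N : Config n) →
  foldl (letter (suc j)) ([] , []) (cw N) ≡ readColumns j id (at (suc j) N) (at j N) ([] , [])
read-cw {n} j N = go′ id (at (suc j) N) (at j N) _ (λ _ → refl) (λ _ → refl)
  where
  f : ℕ → List (Tag × ℕ)
  f c = map (λ (rrow : ℕ × Subset n) → ((proj₁ rrow , c) , suc (proj₁ rrow))) (keep (λ (rrow : ℕ × Subset n) → getV (proj₂ rrow) c) (reverse (indexed N)))
  go′ : ∀ {m} h (A B : Subset m) s → (∀ i → getV A i ≡ getV (at (suc j) N) (h i)) → (∀ i → getV B i ≡ getV (at j N) (h i)) →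
    foldl (letter (suc j)) s (concatMap f (applyUpTo h m)) ≡ readColumns j h A B s
  go′ h []      []      s p q = refl
  go′ {suc m} h (a ∷ A) (b ∷ B) s p q = begin
    foldl (letter (suc j)) s (f (h 0) ++ concatMap f (applyUpTo (h ∘ suc) m))
      ≡⟨ foldl-++ (letter (suc j)) s (f (h 0)) _ ⟩
    foldl (letter (suc j)) (readRows j (h 0) id N s) (concatMap f (applyUpTo (h ∘ suc) m))
      ≡⟨ cong (λ s → foldl (letter (suc j)) s (concatMap f (applyUpTo (h ∘ suc) m)))
          (trans (readRows-pair j (h 0) id N j s (λ _ → refl) refl) (cong₂ (λ a b → siteStep j (h 0) a b s) (sym (p 0)) (sym (q 0)))) ⟩
    foldl (letter (suc j)) (siteStep j (h 0) a b s) (concatMap f (applyUpTo (h ∘ suc) m))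
      ≡⟨ go′ (h ∘ suc) A B _ (p ∘ suc) (q ∘ suc) ⟩
    readColumns j (h ∘ suc) A B (siteStep j (h 0) a b s) ∎
    where open ≡-Reasoning

firstOpen : Subset n → Subset n → Maybe ℕ
firstOpen []          []          = nothing
firstOpen (true ∷ A)  (false ∷ B) with closes A B
... | zero  = just 0
... | suc _ = Maybe.map suc (firstOpen A B)
firstOpen (true ∷ A)  (true ∷ B)  = Maybe.map suc (firstOpen A B)
firstOpen (false ∷ A) (b ∷ B)     = Maybe.map suc (firstOpen A B)

-- The leftmost unmatched opening bracket is the bottom of the final stack. An opening that is
-- already waiting survives only if the remaining columns have fewer unmatched closing brackets than
-- the stack is high; otherwise the answer lies in those columns.
last-readColumns : ∀ j h (A B : Subset n) st cl →
  last (proj₁ (readColumns j h A B (st , cl))) ≡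
  (if closes A B <ᵇ length st then last st else Maybe.map (λ c → suc j , h c) (firstOpen A B))
last-readColumns j h [] [] []      cl = refl
last-readColumns j h [] [] (_ ∷ _) cl = refl
last-readColumns j h (true ∷ A) (true ∷ B) st cl =
  trans (last-readColumns j (h ∘ suc) A B st cl)
    (cong (λ m → if closes A B <ᵇ length st then last st else m) (Maybe.map-∘ (firstOpen A B)))
last-readColumns j h (false ∷ A) (false ∷ B) st cl =
  trans (last-readColumns j (h ∘ suc) A B st cl)
    (cong (λ m → if closes A B <ᵇ length st then last st else m) (Maybe.map-∘ (firstOpen A B)))
last-readColumns j h (false ∷ A) (true ∷ B) [] cl =
  trans (last-readColumns j (h ∘ suc) A B [] _) (Maybe.map-∘ (firstOpen A B))
last-readColumns j h (false ∷ A) (true ∷ B) (x ∷ []) cl =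
  trans (last-readColumns j (h ∘ suc) A B [] cl) (Maybe.map-∘ (firstOpen A B))
last-readColumns j h (false ∷ A) (true ∷ B) (x ∷ y ∷ st) cl =
  trans (last-readColumns j (h ∘ suc) A B (y ∷ st) cl)
    (cong (λ m → if closes A B <ᵇ length (y ∷ st) then last (y ∷ st) else m) (Maybe.map-∘ (firstOpen A B)))
last-readColumns j h (true ∷ A) (false ∷ B) [] cl
  with closes A B | last-readColumns j (h ∘ suc) A B ((suc j , h 0) ∷ []) cl
... | zero  | e = e
... | suc _ | e = trans e (Maybe.map-∘ (firstOpen A B))
last-readColumns j h (true ∷ A) (false ∷ B) (x ∷ st) cl
  with closes A B | last-readColumns j (h ∘ suc) A B ((suc j , h 0) ∷ x ∷ st) cl
... | zero  | e = e
... | suc u | e = trans e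
  (cong (λ m → if u <ᵇ length (x ∷ st) then last (x ∷ st) else m) (Maybe.map-∘ (firstOpen A B)))

head-unmatched : ∀ j (N : Config n) →
  head (proj₂ (unmatched (suc j) (cw N))) ≡ Maybe.map (suc j ,_) (firstOpen (at (suc j) N) (at j N))
head-unmatched j N = begin
  head (proj₂ (unmatched (suc j) (cw N)))
    ≡⟨ cong (head ∘ proj₂) (unmatched-foldl (suc j) (cw N)) ⟩
  head (reverse (proj₁ (foldl (letter (suc j)) ([] , []) (cw N))))
    ≡⟨ head-reverse (proj₁ (foldl (letter (suc j)) ([] , []) (cw N))) ⟩
  last (proj₁ (foldl (letter (suc j)) ([] , []) (cw N)))
    ≡⟨ cong (last ∘ proj₁) (read-cw j N) ⟩
  last (proj₁ (readColumns j id (at (suc j) N) (at j N) ([] , [])))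
    ≡⟨ last-readColumns j id (at (suc j) N) (at j N) [] [] ⟩
  Maybe.map (suc j ,_) (firstOpen (at (suc j) N) (at j N)) ∎
  where open ≡-Reasoning

map-suc≡nothing : ∀ m → Maybe.map suc m ≡ nothing → m ≡ nothing
map-suc≡nothing nothing _ = refl

firstOpen-nothing : (A B : Subset n) → firstOpen A B ≡ nothing → opens A B ≡ 0 × up A B ≡ A × low A B ≡ B
firstOpen-nothing [] [] _ = refl , refl , refl
firstOpen-nothing (true ∷ A) (false ∷ B) e with closes A B
... | suc _ with firstOpen-nothing A B (map-suc≡nothing _ e)
...   | o , u , l = o , cong (true ∷_) u , cong (false ∷_) l
firstOpen-nothing (true ∷ A) (true ∷ B) e with firstOpen-nothing A B (map-suc≡nothing _ e)
... | o , u , l = o , cong (true ∷_) u , cong (true ∷_) l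
firstOpen-nothing (false ∷ A) (b ∷ B) e with firstOpen-nothing A B (map-suc≡nothing _ e)
... | o , u , l = o , cong (false ∷_) u , cong (b ∷_) l

map-suc≡just : ∀ {c} m → Maybe.map suc m ≡ just c → ∃ λ c′ → m ≡ just c′ × c ≡ suc c′
map-suc≡just (just c′) refl = c′ , refl , refl

-- Lowering the leftmost unmatched opening bracket makes it an unmatched closing one and leaves all
-- matchings intact. So e↓ takes one step along a string without changing its top.
firstOpen-just : ∀ (A B : Subset n) {c} → firstOpen A B ≡ just c →
  let A′ = setV A c false ; B′ = setV B c true in
  closes A′ B′ ≡ suc (closes A B) × suc (opens A′ B′) ≡ opens A B × up A′ B′ ≡ up A B × low A′ B′ ≡ low A B
firstOpen-just [] [] ()
firstOpen-just (true ∷ A) (false ∷ B) e with closes A B in eq | e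
... | zero  | refl rewrite eq = refl , refl , refl , refl
... | suc _ | e with map-suc≡just (firstOpen A B) e
...   | c , e′ , refl with firstOpen-just A B e′
...     | k , o , u , l rewrite k | eq = refl , o , cong (true ∷_) u , cong (false ∷_) l
firstOpen-just (true ∷ A) (true ∷ B) e with map-suc≡just (firstOpen A B) e
... | c , e′ , refl with firstOpen-just A B e′
...   | k , o , u , l = k , o , cong (true ∷_) u , cong (true ∷_) l
firstOpen-just (false ∷ A) (b ∷ B) e with map-suc≡just (firstOpen A B) e
... | c , e′ , refl with firstOpen-just A B e′
firstOpen-just (false ∷ A) (true ∷ B) e | c , e′ , refl | k , o , u , l = cong suc k , o , cong (false ∷_) u , cong (true ∷_) l
firstOpen-just (false ∷ A) (false ∷ B) e | c , e′ , refl | k , o , u , l = k , o , cong (false ∷_) u , cong (false ∷_) l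

firstOpen-∅ : (B : Subset n) → firstOpen ∅ B ≡ nothing
firstOpen-∅ []      = refl
firstOpen-∅ (b ∷ B) rewrite firstOpen-∅ B = refl

opensAt : ℕ → Config n → ℕ
opensAt j N = opens (at (suc j) N) (at j N)

lowerAll-trivial : ∀ j (N : Config n) → opensAt j N ≡ 0 → lowerAll j N ≡ N
lowerAll-trivial zero    []          _ = refl
lowerAll-trivial (suc j) []          _ = refl
lowerAll-trivial zero    (B ∷ [])    _ = refl
lowerAll-trivial zero    (B ∷ A ∷ N) e with firstOpen A B in eq
... | nothing = cong₂ (λ X Y → X ∷ Y ∷ N) (proj₂ (proj₂ (firstOpen-nothing A B eq))) (proj₁ (proj₂ (firstOpen-nothing A B eq)))
... | just c with () ← trans (proj₁ (proj₂ (firstOpen-just A B eq))) e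
lowerAll-trivial (suc j) (r ∷ N)     e = cong (r ∷_) (lowerAll-trivial j N e)

lowerBall : ℕ → ℕ → Config n → Config n
lowerBall j c N = updRow (updRow N (suc j) (λ row → setV row c false)) j (λ row → setV row c true)

lowerBall-first : ∀ j (N : Config n) c → firstOpen (at (suc j) N) (at j N) ≡ just c →
  suc (opensAt j (lowerBall j c N)) ≡ opensAt j N × lowerAll j (lowerBall j c N) ≡ lowerAll j N
lowerBall-first {n} j   []          c e with () ← trans (sym (firstOpen-∅ (∅ {n}))) e
lowerBall-first zero    (B ∷ [])    c e with () ← trans (sym (firstOpen-∅ B)) e
lowerBall-first zero    (B ∷ A ∷ N) c e with firstOpen-just A B e
... | _ , o , u , l = o , cong₂ (λ X Y → X ∷ Y ∷ N) l u
lowerBall-first (suc j) (r ∷ N)     c e with lowerBall-first j N c e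
... | o , s = o , cong (r ∷_) s

eDown-firstOpen : ∀ j (N : Config n) → eDown (suc j) N ≡ Maybe.maybe′ (λ c → lowerBall j c N) N (firstOpen (at (suc j) N) (at j N))
eDown-firstOpen j N with head (proj₂ (unmatched (suc j) (cw N))) | head-unmatched j N
... | m | e with firstOpen (at (suc j) N) (at j N)
eDown-firstOpen j N | .nothing           | refl | nothing = refl
eDown-firstOpen j N | .(just (suc j , c)) | refl | just c  = refl

iter-eDown : ∀ m j (N : Config n) → opensAt j N ≤ m → iter m (eDown (suc j)) N ≡ lowerAll j N
iter-eDown zero    j N p = sym (lowerAll-trivial j N (n≤0⇒n≡0 p))
iter-eDown (suc m) j N p rewrite eDown-firstOpen j N with firstOpen (at (suc j) N) (at j N) in eq
... | nothing = iter-eDown m j N (≤-trans (≤-reflexive (proj₁ (firstOpen-nothing (at (suc j) N) (at j N) eq))) z≤n)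
... | just c with lowerBall-first j N c eq
...   | o , e = trans (iter-eDown m j _ (s≤s⁻¹ (≤-trans (≤-reflexive o) p))) e

eDownStar-lowerAll : ∀ j (N : Config n) → eDownStar (suc j) N ≡ lowerAll j N
eDownStar-lowerAll {n} j N = iter-eDown n j N (begin
  opensAt j N                                        ≤⟨ m≤n+m _ _ ⟩
  ∣ up (at (suc j) N) (at j N) ∣ + opensAt j N       ≡⟨ ∣up∣ (at (suc j) N) (at j N) ⟩
  ∣ at (suc j) N ∣                                   ≤⟨ ∣p∣≤n (at (suc j) N) ⟩
  n                                                  ∎)
  where open ≤-Reasoning

-- The collapse ρ_N

DominatedAt : ℕ → Config n → Set
DominatedAt j M = Dominated (at (suc j) M) (at j M)

Dominated-∅ : (B : Subset n) → Dominated ∅ B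
Dominated-∅ B = Dominated-⊑ (∅⊑ B) B (Dominated-refl B)
  where
  Dominated-refl : ∀ {n} (B : Subset n) → Dominated B B
  Dominated-refl []      = tt
  Dominated-refl (b ∷ B) = ≤-refl , Dominated-refl B

DominatedAt-lowerAll : ∀ j (M : Config n) → DominatedAt j (lowerAll j M)
DominatedAt-lowerAll zero    []          = Dominated-∅ ∅
DominatedAt-lowerAll (suc j) []          = Dominated-∅ ∅
DominatedAt-lowerAll zero    (B ∷ [])    = Dominated-∅ B
DominatedAt-lowerAll zero    (B ∷ A ∷ M) = Dominated-up-low A B
DominatedAt-lowerAll (suc j) (r ∷ M)     = DominatedAt-lowerAll j M

at-lowerAll-below : ∀ i j (M : Config n) → i < j → at i (lowerAll j M) ≡ at i M
at-lowerAll-below i       (suc j) []      _       = refl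
at-lowerAll-below zero    (suc j) (r ∷ M) _       = refl
at-lowerAll-below (suc i) (suc j) (r ∷ M) (s≤s p) = at-lowerAll-below i j M p

at-lowerAll-above : ∀ i j (M : Config n) → suc j < i → at i (lowerAll j M) ≡ at i M
at-lowerAll-above i             zero    []          _       = refl
at-lowerAll-above i             (suc j) []          _       = refl
at-lowerAll-above (suc (suc i)) zero    (B ∷ [])    _       = refl
at-lowerAll-above (suc (suc i)) zero    (B ∷ A ∷ M) _       = refl
at-lowerAll-above (suc zero)    zero    _           (s≤s ())
at-lowerAll-above (suc i)       (suc j) (r ∷ M)     (s≤s p) = at-lowerAll-above i j M p

DominatedAt-raise-lower : ∀ j (M : Config n) → DominatedAt j M → DominatedAt (suc j) (lowerAll j (lowerAll (suc j) M))
DominatedAt-raise-lower zero    []                _ = Dominated-∅ ∅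
DominatedAt-raise-lower (suc j) []                _ = Dominated-∅ ∅
DominatedAt-raise-lower zero    (A ∷ [])          _ = Dominated-∅ ∅
DominatedAt-raise-lower zero    (A ∷ B ∷ [])      _ = Dominated-∅ _
DominatedAt-raise-lower zero    (A ∷ B ∷ C ∷ M)   d = Dominated-raise-lower A B C d
DominatedAt-raise-lower (suc j) (r ∷ M)           d = DominatedAt-raise-lower j M d

at-sweep : ∀ i m (M : Config n) → m < i → at i (sweep m M) ≡ at i M
at-sweep i zero    M p = refl
at-sweep i (suc m) M p rewrite eDownStar-lowerAll m M = trans (at-sweep i m (lowerAll m M) (≤-trans (n≤1+n _) p)) (at-lowerAll-above i m M p)

-- The topmost new pair is settled by `DominatedAt-raise-lower`, since after two operators the sweep
-- no longer touches its rows. The pairs below are covered by induction on the shorter sweep, whose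
-- hypothesis survives the first operator.
DominatedAt-sweep : ∀ m (M : Config n) → (∀ j → j < m → DominatedAt j M) → ∀ j → j < suc m → DominatedAt j (sweep (suc m) M)
DominatedAt-sweep zero    M h zero _ rewrite eDownStar-lowerAll 0 M = DominatedAt-lowerAll 0 M
DominatedAt-sweep zero    M h (suc j) (s≤s ())
DominatedAt-sweep (suc m) M h j p rewrite eDownStar-lowerAll (suc m) M with m≤n⇒m<n∨m≡n (s≤s⁻¹ p)
... | inj₁ j<sm = DominatedAt-sweep m (lowerAll (suc m) M) kept j j<sm
  where
  kept : ∀ j → j < m → DominatedAt j (lowerAll (suc m) M)
  kept j p rewrite at-lowerAll-below (suc j) (suc m) M (s≤s p) | at-lowerAll-below j (suc m) M (m≤n⇒m≤1+n p) = h j (m≤n⇒m≤1+n p)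
... | inj₂ refl rewrite eDownStar-lowerAll m (lowerAll (suc m) M)
  | at-sweep (suc (suc m)) m (lowerAll m (lowerAll (suc m) M)) (m≤n⇒m≤1+n (n<1+n m)) | at-sweep (suc m) m (lowerAll m (lowerAll (suc m) M)) (n<1+n m)
  = DominatedAt-raise-lower m M (h m (n<1+n m))

DominatedAt-rhoLoop : ∀ k m (M : Config n) → (∀ j → j < m → DominatedAt j M) → ∀ j → j < m + k → DominatedAt j (rhoLoop k (suc m) M)
DominatedAt-rhoLoop zero    m M h j p = h j (subst (j <_) (+-identityʳ m) p)
DominatedAt-rhoLoop (suc k) m M h j p = DominatedAt-rhoLoop k (suc m) (sweep (suc m) M) (DominatedAt-sweep m M h) j (subst (j <_) (+-suc m k) p)

↝-sweep : ∀ m (M : Config n) → M ↝ sweep m M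
↝-sweep zero    M = done
↝-sweep (suc m) M rewrite eDownStar-lowerAll m M = step m (↝-sweep m (lowerAll m M))

↝-rhoLoop : ∀ k m (M : Config n) → M ↝ rhoLoop k m M
↝-rhoLoop zero    m M = done
↝-rhoLoop (suc k) m M = ↝-trans (↝-sweep m M) (↝-rhoLoop k (suc m) (sweep m M))

DominatedAt⇒Nonwrapping : (M : Config n) → (∀ j → j < length M ∸ 1 → DominatedAt j M) → Nonwrapping M
DominatedAt⇒Nonwrapping []          _ = tt
DominatedAt⇒Nonwrapping (B ∷ [])    _ = tt , tt
DominatedAt⇒Nonwrapping (B ∷ A ∷ M) h = h 0 (s≤s z≤n) , DominatedAt⇒Nonwrapping (A ∷ M) (λ j p → h (suc j) (s≤s p))

rhoN-collapse : (M : Config n) → rhoN M ≡ collapse M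
rhoN-collapse M = sym (collapse-unique r (DominatedAt⇒Nonwrapping (rhoN M) dom))
  where
  r : M ↝ rhoN M
  r = ↝-rhoLoop (length M ∸ 1) 1 M
  dom : ∀ j → j < length (rhoN M) ∸ 1 → DominatedAt j (rhoN M)
  dom j p = DominatedAt-rhoLoop (length M ∸ 1) 0 M (λ _ ()) j (subst (λ l → j < l ∸ 1) (length-↝ r) p)

-- FM labelling through thresholds

atLeast : ∀ n → ℕ → List ℕ → Subset n
atLeast zero    ℓ a       = []
atLeast (suc n) ℓ []      = (ℓ ≤ᵇ 0) ∷ atLeast n ℓ []
atLeast (suc n) ℓ (x ∷ a) = (ℓ ≤ᵇ x) ∷ atLeast n ℓ a

getV-atLeast : ∀ ℓ a k → k < n → getV (atLeast n ℓ a) k ≡ (ℓ ≤ᵇ get a k)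
getV-atLeast {suc n} ℓ []      zero    _       = refl
getV-atLeast {suc n} ℓ (x ∷ a) zero    _       = refl
getV-atLeast {suc n} ℓ []      (suc k) (s≤s p) = getV-atLeast ℓ [] k p
getV-atLeast {suc n} ℓ (x ∷ a) (suc k) (s≤s p) = getV-atLeast ℓ a k p

≤⇒≤ᵇ≡true : ∀ {m n} → m ≤ n → (m ≤ᵇ n) ≡ true
≤⇒≤ᵇ≡true {zero} _ = refl
≤⇒≤ᵇ≡true {suc m} {suc n} (s≤s p) with m | ≤⇒≤ᵇ≡true p
... | zero  | _ = refl
... | suc _ | e = e

>⇒≤ᵇ≡false : ∀ {m n} → n < m → (m ≤ᵇ n) ≡ false
>⇒≤ᵇ≡false {suc m} {zero}  _       = refl
>⇒≤ᵇ≡false {suc (suc m)} {suc n} (s≤s p) = >⇒≤ᵇ≡false {suc m} {n} p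
>⇒≤ᵇ≡false {suc zero}    {suc n} (s≤s ())

atLeast-setL-≤ : ∀ {ℓ v} a k → length a ≡ n → ℓ ≤ v → atLeast n ℓ (setL a k v) ≡ setV (atLeast n ℓ a) k true
atLeast-setL-≤ []      k       refl p = refl
atLeast-setL-≤ (x ∷ a) zero    refl p = cong (_∷ _) (≤⇒≤ᵇ≡true p)
atLeast-setL-≤ (x ∷ a) (suc k) refl p = cong (_ ∷_) (atLeast-setL-≤ a k refl p)

atLeast-setL-> : ∀ {ℓ v} a k → length a ≡ n → v < ℓ → get a k ≡ 0 → atLeast n ℓ (setL a k v) ≡ atLeast n ℓ a
atLeast-setL-> []      k       refl p e = refl
atLeast-setL-> {ℓ = ℓ} (x ∷ a) zero refl p refl = cong (_∷ _) (trans (>⇒≤ᵇ≡false p) (sym (>⇒≤ᵇ≡false (≤-trans (s≤s z≤n) p))))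
atLeast-setL-> (x ∷ a) (suc k) refl p e = cong (_ ∷_) (atLeast-setL-> a k refl p e)

atLeast-zeros : ∀ n ℓ → 1 ≤ ℓ → atLeast n ℓ (replicate n 0) ≡ ∅
atLeast-zeros zero    ℓ p = refl
atLeast-zeros (suc n) ℓ p = cong₂ _∷_ (>⇒≤ᵇ≡false p) (atLeast-zeros n ℓ p)

length-setL : ∀ a k v → length (setL a k v) ≡ length a
length-setL []      k       v = refl
length-setL (x ∷ a) zero    v = refl
length-setL (x ∷ a) (suc k) v = cong suc (length-setL a k v)

-- As for go: the unification in fmStep-assignment names the local function pairOne.
mutual
  pairOne : ∀ {n} → ℕ → ℕ → List ℕ → Subset n → List ℕ → ℕ → List ℕ
  pairOne = _

  assignment : ∀ {n} → ℕ → ℕ → List ℕ → Subset n → List ℕ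
  assignment {n} L d above row = foldl (pairOne L d above row) (replicate n 0)
    (concatMap (λ ℓ → keep (λ j → get above j ≡ᵇ ℓ) (upTo n)) (labelsDesc L))

  fmStep-assignment : ∀ {n} L d above (row : Subset n) → fmStep L d above row ≡
    map (λ k → if getV row k then (if get (assignment L d above row) k ≡ᵇ 0 then d else get (assignment L d above row) k) else 0) (upTo n)
  fmStep-assignment L d above row = refl

get-fmStep : ∀ L d above (row : Subset n) k → k < n → get (fmStep L d above row) k ≡
  (if getV row k then (if get (assignment L d above row) k ≡ᵇ 0 then d else get (assignment L d above row) k) else 0)
get-fmStep {n} L d above row k p = get-map-applyUpTo id n k p
  where
  get-map-applyUpTo : ∀ {g : ℕ → ℕ} h m k → k < m → get (map g (applyUpTo h m)) k ≡ g (h k)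
  get-map-applyUpTo h (suc m) zero    _       = refl
  get-map-applyUpTo h (suc m) (suc k) (s≤s p) = get-map-applyUpTo (h ∘ suc) m k p

candidates : ℕ → ℕ → List ℕ
candidates n j = drop j (upTo n) ++ take j (upTo n)

available : Subset n → List ℕ → ℕ → Bool
available row a k = getV row k ∧ (get a k ≡ᵇ 0)

pairOne-findFirst : ∀ L d above (row : Subset n) a j → pairOne L d above row a j ≡
  Maybe.maybe′ (λ k → setL a k (get above j)) a (findFirst (available row a) (candidates n j))
pairOne-findFirst {n} L d above row a j with findFirst (available row a) (candidates n j)
... | nothing = refl
... | just k  = refl

findFirst-++ : ∀ p xs ys → findFirst p (xs ++ ys) ≡ (findFirst p xs <∣> findFirst p ys)
findFirst-++ p []       ys = refl
findFirst-++ p (x ∷ xs) ys with p x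
... | true  = refl
... | false = findFirst-++ p xs ys

findFirst-true : ∀ p xs {k} → findFirst p xs ≡ just k → p k ≡ true
findFirst-true p (x ∷ xs) e with p x in eq
findFirst-true p (x ∷ xs) refl | true = eq
... | false = findFirst-true p xs e

findFirst-drop : ∀ p j h (v : Subset n) → (∀ i → i < n → p (h i) ≡ getV v i) →
  findFirst p (drop j (applyUpTo h n)) ≡ Maybe.map h (nextFrom j v)
findFirst-drop p zero    h []          e = refl
findFirst-drop p (suc j) h []          e = refl
findFirst-drop p zero    h (true ∷ v)  e rewrite e 0 (s≤s z≤n) = refl
findFirst-drop p zero    h (false ∷ v) e rewrite e 0 (s≤s z≤n) =
  trans (findFirst-drop p 0 (h ∘ suc) v (λ i q → e (suc i) (s≤s q))) (Maybe.map-∘ (nextFrom 0 v))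
findFirst-drop p (suc j) h (_ ∷ v)     e =
  trans (findFirst-drop p j (h ∘ suc) v (λ i q → e (suc i) (s≤s q))) (Maybe.map-∘ (nextFrom j v))

findFirst-spot : ∀ p j (v : Subset n) → (∀ i → i < n → p i ≡ getV v i) → findFirst p (candidates n j) ≡ spot j v
findFirst-spot {n} p j v e = trans (findFirst-++ p (drop j (upTo n)) (take j (upTo n))) (go′ (nextFrom j v) from)
  where
  from : findFirst p (drop j (upTo n)) ≡ nextFrom j v
  from = trans (findFirst-drop p j id v e) (Maybe.map-id _)
  start : findFirst p (upTo n) ≡ nextFrom 0 v
  start = trans (findFirst-drop p 0 id v e) (Maybe.map-id _)
  go′ : ∀ m → findFirst p (drop j (upTo n)) ≡ m → (findFirst p (drop j (upTo n)) <∣> findFirst p (take j (upTo n))) ≡ (m <∣> nextFrom 0 v)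
  go′ (just k) f rewrite f = refl
  go′ nothing  f rewrite f = begin
    findFirst p (take j (upTo n))                                          ≡⟨ Maybe.<∣>-identityʳ _ ⟨
    (findFirst p (take j (upTo n)) <∣> nothing)                            ≡⟨ cong (findFirst p (take j (upTo n)) <∣>_) f ⟨
    (findFirst p (take j (upTo n)) <∣> findFirst p (drop j (upTo n)))      ≡⟨ findFirst-++ p (take j (upTo n)) _ ⟨
    findFirst p (take j (upTo n) ++ drop j (upTo n))                       ≡⟨ cong (findFirst p) (take++drop≡id j (upTo n)) ⟩
    findFirst p (upTo n)                                                   ≡⟨ start ⟩
    nextFrom 0 v                                                           ∎
    where open ≡-Reasoning

getV-free : ∀ (B O : Subset n) k → getV (free B O) k ≡ (getV B k ∧ not (getV O k))
getV-free []      []      k       = refl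
getV-free (_ ∷ _) (_ ∷ _) zero    = refl
getV-free (_ ∷ B) (_ ∷ O) (suc k) = getV-free B O k

available-free : ∀ (row : Subset n) a i → i < n → available row a i ≡ getV (free row (atLeast n 1 a)) i
available-free {n} row a i p rewrite getV-free row (atLeast n 1 a) i | getV-atLeast 1 a i p with get a i
... | zero  = refl
... | suc _ = refl

module _ {n : ℕ} (L d : ℕ) (above : List ℕ) (row : Subset n) where

  private
    pair : List ℕ → ℕ → List ℕ
    pair = pairOne L d above row

  -- `P` is the set of cars parked so far. By `high`, all labels given are at least v, so the set of
  -- labelled sites, which governs the search, is also the set at threshold v.
  record Step (v : ℕ) (P : Subset n) (a : List ℕ) : Set where
    field
      len   : length a ≡ n
      high  : atLeast n 1 a ≡ atLeast n v a
      good  : Parking P row (atLeast n 1 a)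

  open Step

  -- The search is one application of `Parking-insert`. The chosen site was unlabelled, so writing v
  -- there cannot change a threshold above v.
  pair-step : ∀ v P a j → 1 ≤ v → j < n → getV P j ≡ false → get above j ≡ v → Step v P a →
    Step v (setV P j true) (pair a j) × (∀ ℓ → v < ℓ → atLeast n ℓ (pair a j) ≡ atLeast n ℓ a)
  pair-step v P a j 1≤v j<n Pj refl s
    rewrite pairOne-findFirst L d above row a j
    with findFirst (available row a) (candidates n j) in eq
       | findFirst-spot (available row a) j (free row (atLeast n 1 a)) (available-free row a)
       | Parking-insert j P row (atLeast n 1 a) j<n Pj (good s)
  ... | nothing | e | g rewrite sym e = record { len = len s ; high = high s ; good = g } , λ _ _ → refl
  ... | just k  | e | g rewrite sym e =
    record { len = trans (length-setL a k v) (len s)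
           ; high = trans (atLeast-setL-≤ a k (len s) 1≤v)
                      (trans (cong (λ O → setV O k true) (high s)) (sym (atLeast-setL-≤ a k (len s) ≤-refl)))
           ; good = subst (Parking _ row) (sym (atLeast-setL-≤ a k (len s) 1≤v)) g } ,
    λ ℓ p → atLeast-setL-> a k (len s) p zero′
    where
    zero′ : get a k ≡ 0
    zero′ with getV row k | get a k | findFirst-true (available row a) (candidates n j) eq
    ... | true | zero | _ = refl

  insertAll : Subset n → List ℕ → Subset n
  insertAll = foldl (λ P j → setV P j true)

  pairs-step : ∀ v P a js → 1 ≤ v → All (λ j → j < n × getV P j ≡ false × get above j ≡ v) js → AllPairs _≢_ js → Step v P a →
    Step v (insertAll P js) (foldl pair a js) × (∀ ℓ → v < ℓ → atLeast n ℓ (foldl pair a js) ≡ atLeast n ℓ a)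
  pairs-step v P a []       1≤v _ _ s = s , λ _ _ → refl
  pairs-step v P a (j ∷ js) 1≤v ((j<n , Pj , aj) ∷ h) (u ∷ us) s with pair-step v P a j 1≤v j<n Pj aj s
  ... | s′ , same with pairs-step v (setV P j true) (pair a j) js 1≤v (All.zipWith fresh (h , u)) us s′
    where
    getV-setV-≢ : ∀ {n} (P : Subset n) j k → j ≢ k → getV (setV P j true) k ≡ getV P k
    getV-setV-≢ []      j       k       _ = refl
    getV-setV-≢ (_ ∷ P) zero    zero    e = contradiction refl e
    getV-setV-≢ (_ ∷ P) zero    (suc k) e = refl
    getV-setV-≢ (_ ∷ P) (suc j) zero    e = refl
    getV-setV-≢ (_ ∷ P) (suc j) (suc k) e = getV-setV-≢ P j k (e ∘ cong suc)
    fresh : ∀ {k} → (k < n × getV P k ≡ false × get above k ≡ v) × j ≢ k → k < n × getV (setV P j true) k ≡ false × get above k ≡ v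
    fresh {k} ((k<n , Pk , ak) , j≢k) = k<n , trans (getV-setV-≢ P j k j≢k) Pk , ak
  ... | s″ , same′ = s″ , λ ℓ p → trans (same′ ℓ p) (same ℓ p)

  labelled : ℕ → List ℕ
  labelled ℓ = keep (λ j → get above j ≡ᵇ ℓ) (upTo n)

  record Processed (m : ℕ) (a : List ℕ) : Set where
    field
      parked : Step (suc m) (atLeast n (suc m) above) a
      exact  : ∀ ℓ → m < ℓ → atLeast n ℓ a ≡ occupied (atLeast n ℓ above) row

  open Processed

  insert-labelled : ∀ m → insertAll (atLeast n (suc m) above) (labelled m) ≡ atLeast n m above
  insert-labelled m = getV-ext _ _ same
    where
    elem : ℕ → List ℕ → Bool
    elem k []       = false
    elem k (j ∷ js) = (k ≡ᵇ j) ∨ elem k js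
    getV-setV : ∀ {n} (P : Subset n) j k → k < n → getV (setV P j true) k ≡ (getV P k ∨ (k ≡ᵇ j))
    getV-setV (b ∷ P) zero    zero    _       = sym (∨-zeroʳ b)
    getV-setV (b ∷ P) zero    (suc k) _       = sym (∨-identityʳ _)
    getV-setV (b ∷ P) (suc j) zero    _       = sym (∨-identityʳ b)
    getV-setV (b ∷ P) (suc j) (suc k) (s≤s p) = getV-setV P j k p
    getV-insertAll : ∀ P js k → k < n → getV (insertAll P js) k ≡ (getV P k ∨ elem k js)
    getV-insertAll P []       k p = sym (∨-identityʳ _)
    getV-insertAll P (j ∷ js) k p = trans (getV-insertAll (setV P j true) js k p)
      (trans (cong (_∨ elem k js) (getV-setV P j k p)) (∨-assoc (getV P k) _ _))
    elem-keep : ∀ p k xs → elem k (keep p xs) ≡ (p k ∧ elem k xs)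
    elem-keep p k [] = sym (∧-zeroʳ (p k))
    elem-keep p k (x ∷ xs) with k ≡ᵇ x in e
    elem-keep p k (x ∷ xs) | true with refl ← ≡ᵇ⇒≡ k x (subst T (sym e) tt) with p k in pk
    ... | true  rewrite e = refl
    ... | false = trans (elem-keep p k xs) (cong (_∧ elem k xs) pk)
    elem-keep p k (x ∷ xs) | false with p x
    ... | true  rewrite e = elem-keep p k xs
    ... | false = elem-keep p k xs
    elem-applyUpTo : ∀ h m k → k < m → elem (h k) (applyUpTo h m) ≡ true
    elem-applyUpTo h (suc m) zero    _       rewrite ≡ᵇ-refl (h 0) = refl
    elem-applyUpTo h (suc m) (suc k) (s≤s p) rewrite elem-applyUpTo (h ∘ suc) m k p = ∨-zeroʳ _
    split : ∀ m x → ((suc m ≤ᵇ x) ∨ ((x ≡ᵇ m) ∧ true)) ≡ (m ≤ᵇ x)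
    split zero          zero    = refl
    split zero          (suc x) = refl
    split (suc m)       zero    = refl
    split (suc zero)    (suc x) = split zero x
    split (suc (suc m)) (suc x) = split (suc m) x
    same : ∀ k → k < n → getV (insertAll (atLeast n (suc m) above) (labelled m)) k ≡ getV (atLeast n m above) k
    same k p rewrite getV-insertAll (atLeast n (suc m) above) (labelled m) k p
      | getV-atLeast (suc m) above k p | getV-atLeast m above k p
      | elem-keep (λ j → get above j ≡ᵇ m) k (upTo n) | elem-applyUpTo id n k p = split m (get above k)

  high-pred : ∀ m a → atLeast n 1 a ≡ atLeast n (suc (suc m)) a → atLeast n 1 a ≡ atLeast n (suc m) a
  high-pred m a e = getV-ext _ _ same
    where
    same : ∀ k → k < n → getV (atLeast n 1 a) k ≡ getV (atLeast n (suc m) a) k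
    same k p with cong (λ v → getV v k) e
    ... | e′ rewrite getV-atLeast 1 a k p | getV-atLeast (suc m) a k p | getV-atLeast (suc (suc m)) a k p with get a k
    ...   | zero  = refl
    ...   | suc x = sym (≤⇒≤ᵇ≡true (≤-trans (n≤1+n _) (≤ᵇ⇒≤ (suc (suc m)) (suc x) (subst T e′ tt))))

  labelled-fresh : ∀ m → All (λ j → j < n × getV (atLeast n (suc m) above) j ≡ false × get above j ≡ m) (labelled m)
  labelled-fresh m = keep-All (upTo n) (All.all-upTo n)
    where
    keep-All : ∀ js → All (_< n) js →
      All (λ j → j < n × getV (atLeast n (suc m) above) j ≡ false × get above j ≡ m) (keep (λ j → get above j ≡ᵇ m) js)
    keep-All []       []       = []
    keep-All (j ∷ js) (p ∷ ps) with get above j ≡ᵇ m in e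
    ... | false = keep-All js ps
    ... | true  = (p , trans (getV-atLeast (suc m) above j p) (>⇒≤ᵇ≡false (s≤s (≤-reflexive eq))) , eq) ∷ keep-All js ps
      where
      eq : get above j ≡ m
      eq = ≡ᵇ⇒≡ (get above j) m (subst T (sym e) tt)

  labelled-unique : ∀ m → AllPairs _≢_ (labelled m)
  labelled-unique m = keep-AllPairs (upTo n) (Unique.upTo⁺ n)
    where
    keep-All : ∀ {x} js → All (x ≢_) js → All (x ≢_) (keep (λ j → get above j ≡ᵇ m) js)
    keep-All []       []       = []
    keep-All (j ∷ js) (p ∷ ps) with get above j ≡ᵇ m
    ... | true  = p ∷ keep-All js ps
    ... | false = keep-All js ps
    keep-AllPairs : ∀ js → AllPairs _≢_ js → AllPairs _≢_ (keep (λ j → get above j ≡ᵇ m) js)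
    keep-AllPairs []       []       = []
    keep-AllPairs (j ∷ js) (p ∷ ps) with get above j ≡ᵇ m
    ... | true  = keep-All js p ∷ keep-AllPairs js ps
    ... | false = keep-AllPairs js ps

  module _ (small : ∀ ℓ → 1 ≤ ℓ → ∣ atLeast n ℓ above ∣ ≤ ∣ row ∣) where

    process : ∀ m a → Processed m a → Processed 0 (foldl pair a (concatMap labelled (labelsDesc m)))
    process zero    a p = p
    process (suc m) a p rewrite foldl-++ pair a (labelled (suc m)) (concatMap labelled (labelsDesc m)) =
      process m a′ (record { parked = s′ ; exact = exact′ })
      where
      a′ : List ℕ
      a′ = foldl pair a (labelled (suc m))
      both′ = pairs-step (suc m) (atLeast n (suc (suc m)) above) a (labelled (suc m)) (s≤s z≤n)
        (labelled-fresh (suc m)) (labelled-unique (suc m))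
        (record { len = len (parked p) ; high = high-pred m a (high (parked p)) ; good = good (parked p) })
      s′ : Step (suc m) (atLeast n (suc m) above) a′
      s′ = subst (λ P → Step (suc m) P a′) (insert-labelled (suc m)) (proj₁ both′)
      exact′ : ∀ ℓ → m < ℓ → atLeast n ℓ a′ ≡ occupied (atLeast n ℓ above) row
      exact′ ℓ m<ℓ with m≤n⇒m<n∨m≡n m<ℓ
      ... | inj₁ sm<ℓ = trans (proj₂ both′ ℓ sm<ℓ) (exact p ℓ sm<ℓ)
      -- With all labels above m processed, the labelled sites are exactly those at threshold
      -- `suc m`, and the parking result depends only on the set of cars.
      ... | inj₂ refl = trans (sym (high s′)) (Parking⇒occupied _ row _ (small (suc m) (s≤s z≤n)) (good s′))

    module _ (bounded : ∀ ℓ → L < ℓ → atLeast n ℓ above ≡ ∅) where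

      atLeast-assignment : ∀ ℓ → 1 ≤ ℓ → atLeast n ℓ (assignment L d above row) ≡ occupied (atLeast n ℓ above) row
      atLeast-assignment = exact (process L (replicate n 0) (record
        { parked = record
          { len  = length-replicate n
          ; high = trans (atLeast-zeros n 1 ≤-refl) (sym (atLeast-zeros n (suc L) (s≤s z≤n)))
          ; good = subst₂ (λ P O → Parking P row O) (sym (bounded (suc L) ≤-refl)) (sym (atLeast-zeros n 1 ≤-refl)) (Parking-∅ row) }
        ; exact = λ ℓ p → trans (atLeast-zeros n ℓ (≤-trans (s≤s z≤n) p))
            (sym (trans (cong (λ S → occupied S row) (bounded ℓ p)) (occupied-∅ row))) }))

      atLeast-fmStep-high : ∀ ℓ → d < ℓ → atLeast n ℓ (fmStep L d above row) ≡ occupied (atLeast n ℓ above) row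
      atLeast-fmStep-high ℓ d<ℓ = getV-ext _ _ same
        where
        assigned : ∀ k → k < n → getV (occupied (atLeast n ℓ above) row) k ≡ (ℓ ≤ᵇ get (assignment L d above row) k)
        assigned k p = trans (cong (λ v → getV v k) (sym (atLeast-assignment ℓ (≤-trans (s≤s z≤n) d<ℓ)))) (getV-atLeast ℓ (assignment L d above row) k p)
        same : ∀ k → k < n → getV (atLeast n ℓ (fmStep L d above row)) k ≡ getV (occupied (atLeast n ℓ above) row) k
        same k p rewrite getV-atLeast ℓ (fmStep L d above row) k p | get-fmStep L d above row k p with getV row k in r
        ... | false = trans (>⇒≤ᵇ≡false (≤-trans (s≤s z≤n) d<ℓ)) (sym (getV-⊑ (occupiedFrom⊑ _ (atLeast n ℓ above) row) k r))
        ... | true with get (assignment L d above row) k | assigned k p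
        ...   | zero  | e = trans (>⇒≤ᵇ≡false d<ℓ) (sym (trans e (>⇒≤ᵇ≡false (≤-trans (s≤s z≤n) d<ℓ))))
        ...   | suc x | e = sym e

      -- By hypothesis no label above lies strictly between 0 and `suc d`. Every ball of the row
      -- thus gets either the default d or an inherited label beyond d.
      atLeast-fmStep-low : ∀ ℓ → 1 ≤ ℓ → ℓ ≤ d → atLeast n 1 above ≡ atLeast n (suc d) above →
        atLeast n ℓ (fmStep L d above row) ≡ row
      atLeast-fmStep-low ℓ 1≤ℓ ℓ≤d e = getV-ext _ _ same
        where
        jump : atLeast n 1 (assignment L d above row) ≡ atLeast n (suc d) (assignment L d above row)
        jump = trans (atLeast-assignment 1 ≤-refl) (trans (cong (λ S → occupied S row) e) (sym (atLeast-assignment (suc d) (s≤s z≤n))))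
        same : ∀ k → k < n → getV (atLeast n ℓ (fmStep L d above row)) k ≡ getV row k
        same k p rewrite getV-atLeast ℓ (fmStep L d above row) k p | get-fmStep L d above row k p with getV row k
        ... | false = >⇒≤ᵇ≡false 1≤ℓ
        ... | true with cong (λ v → getV v k) jump
        ...   | j rewrite getV-atLeast 1 (assignment L d above row) k p | getV-atLeast (suc d) (assignment L d above row) k p
            with get (assignment L d above row) k
        ...     | zero  = ≤⇒≤ᵇ≡true ℓ≤d
        ...     | suc x = ≤⇒≤ᵇ≡true (≤-trans ℓ≤d (≤-trans (n≤1+n d) (≤ᵇ⇒≤ (suc d) (suc x) (subst T j tt))))

-- Types and keys

-- Labels of row d are 0 or at least d, so all thresholds ℓ ≤ d give key 0.
Represents : ℕ → List (Subset n) → List ℕ → Set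
Represents {n} d K lab = ∀ ℓ → 1 ≤ ℓ → atLeast n ℓ lab ≡ at (ℓ ∸ d) K

Decreasing : Config n → Set
Decreasing []      = ⊤
Decreasing (r ∷ M) = ∣ at 0 M ∣ ≤ ∣ r ∣ × Decreasing M

labels : ℕ → ℕ → Config n → List ℕ
labels {n} L d []      = replicate n 0
labels     L d (r ∷ M) = fmStep L d (labels L (suc d) M) r

at-beyond : ∀ i (K : List (Subset n)) → length K ≤ i → at i K ≡ ∅
at-beyond i       []      _       = refl
at-beyond (suc i) (S ∷ K) (s≤s p) = at-beyond i K p

length-keys : (M : Config n) → length (keys M) ≡ length M
length-keys []      = refl
length-keys (r ∷ M) = cong suc (trans (length-map _ (keys M)) (length-keys M))

-- The equation says that the top row of M has number L when its bottom row has number d; this is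
-- what keeps all labels within `labelsDesc L`.
labels-keys : ∀ L d (M : Config n) → 1 ≤ d → length M + d ≡ suc L → Decreasing M → Represents d (keys M) (labels L d M)
labels-keys {n} L d [] 1≤d e _ ℓ 1≤ℓ = atLeast-zeros n ℓ 1≤ℓ
labels-keys {n} L d (r ∷ M) 1≤d e (r≥ , dec) ℓ 1≤ℓ = [ low′ , high′ ]′ (≤-<-connex ℓ d)
  where
  above : List ℕ
  above = labels L (suc d) M
  rep : Represents (suc d) (keys M) above
  rep = labels-keys L (suc d) M (s≤s z≤n) (trans (+-suc _ d) e) dec
  -- Thresholds 1 and `suc d` both select key 0 of the rows above, by truncated subtraction.
  jump : atLeast n 1 above ≡ atLeast n (suc d) above
  jump = trans (rep 1 ≤-refl) (sym (trans (rep (suc d) (s≤s z≤n))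
    (cong (λ i → at i (keys M)) (trans (n∸n≡0 d) (sym (0∸n≡0 d))))))
  at⊑ : ∀ {S : Subset n} {K} i → All (_⊑ S) K → at i K ⊑ S
  at⊑ i       []       = ∅⊑ _
  at⊑ zero    (p ∷ _)  = p
  at⊑ (suc i) (_ ∷ ps) = at⊑ i ps
  small : ∀ ℓ → 1 ≤ ℓ → ∣ atLeast n ℓ above ∣ ≤ ∣ r ∣
  small ℓ p = ≤-trans (≤-reflexive (cong ∣_∣ (rep ℓ p))) (≤-trans (⊑⇒≤ (at⊑ (ℓ ∸ suc d) (keys⊑ M))) r≥)
  bounded : ∀ ℓ → L < ℓ → atLeast n ℓ above ≡ ∅
  bounded ℓ p = trans (rep ℓ (≤-trans (s≤s z≤n) p)) (at-beyond (ℓ ∸ suc d) (keys M)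
    (≤-trans (≤-reflexive (length-keys M)) (m+n≤o⇒m≤o∸n (length M) (≤-trans (≤-reflexive (trans (+-suc _ d) e)) p))))
  low′ : ℓ ≤ d → atLeast n ℓ (fmStep L d above r) ≡ at (ℓ ∸ d) (keys (r ∷ M))
  low′ ℓ≤d = trans (atLeast-fmStep-low L d above r small bounded ℓ 1≤ℓ ℓ≤d jump)
    (sym (cong (λ i → at i (keys (r ∷ M))) (m≤n⇒m∸n≡0 ℓ≤d)))
  high′ : d < ℓ → atLeast n ℓ (fmStep L d above r) ≡ at (ℓ ∸ d) (keys (r ∷ M))
  high′ d<ℓ = begin
    atLeast n ℓ (fmStep L d above r)            ≡⟨ atLeast-fmStep-high L d above r small bounded ℓ d<ℓ ⟩
    occupied (atLeast n ℓ above) r                   ≡⟨ cong (λ S → occupied S r) (rep ℓ 1≤ℓ) ⟩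
    occupied (at (ℓ ∸ suc d) (keys M)) r             ≡⟨ at-map-occupied (ℓ ∸ suc d) (keys M) r ⟨
    at (suc (ℓ ∸ suc d)) (keys (r ∷ M))         ≡⟨ cong (λ i → at i (keys (r ∷ M))) (+-∸-assoc 1 d<ℓ) ⟨
    at (ℓ ∸ d) (keys (r ∷ M))                   ∎
    where open ≡-Reasoning

fmGo-∷ʳ : ∀ L D lab (xs : Config n) x → fmGo L D lab (xs ∷ʳ x) ≡ fmStep L (D ∸ length xs) (fmGo L D lab xs) x
fmGo-∷ʳ L D lab []       x = refl
fmGo-∷ʳ L D lab (y ∷ xs) x = trans (fmGo-∷ʳ L (D ∸ 1) (fmStep L D lab y) xs x)
  (cong (λ e → fmStep L e (fmGo L (D ∸ 1) (fmStep L D lab y) xs) x) (∸-+-assoc D 1 (length xs)))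

-- `fmGo` consumes rows from the top and counts the default label down from D, the number of the top
-- row, while `labels` recurses from the bottom row d.
fmGo-labels : ∀ L d D (M : Config n) → suc D ≡ length M + d → fmGo L D (replicate n 0) (reverse M) ≡ labels L d M
fmGo-labels L d D []      e = refl
fmGo-labels {n} L d D (r ∷ M) e = begin
  fmGo L D (replicate n 0) (reverse (r ∷ M))
    ≡⟨ cong (fmGo L D (replicate n 0)) (unfold-reverse r M) ⟩
  fmGo L D (replicate n 0) (reverse M ∷ʳ r)
    ≡⟨ fmGo-∷ʳ L D _ (reverse M) r ⟩
  fmStep L (D ∸ length (reverse M)) (fmGo L D (replicate n 0) (reverse M)) r
    ≡⟨ cong₂ (λ x y → fmStep L x y r) default (fmGo-labels L (suc d) D M (trans e (sym (+-suc (length M) d)))) ⟩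
  fmStep L d (labels L (suc d) M) r ∎
  where
  open ≡-Reasoning
  default : D ∸ length (reverse M) ≡ d
  default = trans (cong₂ _∸_ (suc-injective e) (length-reverse M)) (m+n∸m≡n (length M) d)

typeOf-keys : (M : Config n) → Decreasing M → Represents 1 (keys M) (typeOf M)
typeOf-keys M dec rewrite fmGo-labels (length M) 1 (length M) M (sym (+-comm (length M) 1)) =
  labels-keys (length M) 1 M ≤-refl (+-comm (length M) 1) dec

length-typeOf : (M : Config n) → length (typeOf M) ≡ n
length-typeOf {n} M = trans (cong length (fmGo-labels (length M) 1 (length M) M (sym (+-comm (length M) 1)))) (go′ M)
  where
  go′ : ∀ {L d} (M : Config n) → length (labels L d M) ≡ n
  go′ []      = length-replicate n
  go′ (r ∷ M) = trans (length-map _ (upTo n)) (length-upTo n)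

at-ext : (K K′ : List (Subset n)) → length K ≡ length K′ → (∀ i → i < length K → at i K ≡ at i K′) → K ≡ K′
at-ext []      []        _ _ = refl
at-ext (S ∷ K) (S′ ∷ K′) l h = cong₂ _∷_ (h 0 (s≤s z≤n)) (at-ext K K′ (suc-injective l) (λ i p → h (suc i) (s≤s p)))

≤ᵇ-ext : ∀ x y → (∀ ℓ → 1 ≤ ℓ → (ℓ ≤ᵇ x) ≡ (ℓ ≤ᵇ y)) → x ≡ y
≤ᵇ-ext zero    zero    h = refl
≤ᵇ-ext zero    (suc y) h with () ← h 1 ≤-refl
≤ᵇ-ext (suc x) zero    h with () ← h 1 ≤-refl
≤ᵇ-ext (suc x) (suc y) h = cong suc (≤ᵇ-ext x y λ { (suc ℓ) _ → h (suc (suc ℓ)) (s≤s z≤n) })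

atLeast-ext : ∀ (a b : List ℕ) → length a ≡ n → length b ≡ n → (∀ ℓ → 1 ≤ ℓ → atLeast n ℓ a ≡ atLeast n ℓ b) → a ≡ b
atLeast-ext []      []      refl _ h = refl
atLeast-ext (x ∷ a) (y ∷ b) refl q h = cong₂ _∷_
  (≤ᵇ-ext x y (λ ℓ p → cong (λ v → getV v 0) (h ℓ p)))
  (atLeast-ext a b refl (suc-injective q) (λ ℓ p → Vec.∷-injectiveʳ (h ℓ p)))

typeOf⇒keys : (M N : Config n) → length M ≡ length N → Decreasing M → Decreasing N → typeOf M ≡ typeOf N → keys M ≡ keys N
typeOf⇒keys {n} M N l dM dN e = at-ext (keys M) (keys N) (trans (length-keys M) (trans l (sym (length-keys N))))
  (λ i _ → trans (sym (typeOf-keys M dM (suc i) (s≤s z≤n))) (trans (cong (atLeast n (suc i)) e) (typeOf-keys N dN (suc i) (s≤s z≤n))))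

keys⇒typeOf : (M N : Config n) → Decreasing M → Decreasing N → keys M ≡ keys N → typeOf M ≡ typeOf N
keys⇒typeOf M N dM dN e = atLeast-ext (typeOf M) (typeOf N) (length-typeOf M) (length-typeOf N)
  (λ ℓ p → trans (typeOf-keys M dM ℓ p) (trans (cong (at (ℓ ∸ 1)) e) (sym (typeOf-keys N dN ℓ p))))

Nonwrapping⇒Decreasing : (M : Config n) → Nonwrapping M → Decreasing M
Nonwrapping⇒Decreasing []          _       = tt
Nonwrapping⇒Decreasing (B ∷ [])    _       = ⊑⇒≤ (∅⊑ B) , tt
Nonwrapping⇒Decreasing (B ∷ A ∷ M) (d , h) = Dominated⇒≤ A B d , Nonwrapping⇒Decreasing (A ∷ M) h

MLQ⇒Decreasing : ∀ λ′ (M : Config n) → IsMLQ n λ′ M → Decreasing M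
MLQ⇒Decreasing {n} λ′ M e = go′ id (firstPart λ′) M (λ _ → refl) (trans e (map-applyUpTo id _ (firstPart λ′)))
  where
  part : ℕ → ℕ
  part r = length (keep (λ p → suc r ≤ᵇ p) λ′)
  antitone : ∀ xs r → length (keep (λ p → suc (suc r) ≤ᵇ p) xs) ≤ length (keep (λ p → suc r ≤ᵇ p) xs)
  antitone []       r = z≤n
  antitone (x ∷ xs) r with suc (suc r) ≤ᵇ x in e | suc r ≤ᵇ x in f
  ... | true  | true  = s≤s (antitone xs r)
  ... | false | true  = m≤n⇒m≤1+n (antitone xs r)
  ... | false | false = antitone xs r
  ... | true  | false with () ← trans (sym f) (≤⇒≤ᵇ≡true (≤-trans (n≤1+n _) (≤ᵇ⇒≤ (suc (suc r)) x (subst T (sym e) tt))))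
  go′ : ∀ h m (M : Config n) → Consecutive h → map ∣_∣ M ≡ applyUpTo (part ∘ h) m → Decreasing M
  go′ h m       []          c e = tt
  go′ h (suc m) (r ∷ [])    c e = ⊑⇒≤ (∅⊑ r) , tt
  go′ h (suc (suc m)) (r ∷ s ∷ M) c e = (begin
      ∣ s ∣              ≡⟨ ∷-injectiveˡ (∷-injectiveʳ e) ⟩
      part (h 1)         ≡⟨ cong part (c 0) ⟩
      part (suc (h 0))   ≤⟨ antitone λ′ (h 0) ⟩
      part (h 0)         ≡⟨ ∷-injectiveˡ e ⟨
      ∣ r ∣              ∎) , go′ (h ∘ suc) (suc m) (s ∷ M) (c ∘ suc) (∷-injectiveʳ e)
    where open ≤-Reasoning

-- Component invariants and the conclusion

profile-component : ∀ λ′ i {M N : Config n} → SameComponent n λ′ M N → profile (bringDown i M) ≡ profile (bringDown i N)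
profile-component {n} λ′ i = gfold isEquivalence (λ M → profile (bringDown i M)) edge
  where
  edge : ∀ {M N} → Edge n λ′ M N → profile (bringDown i M) ≡ profile (bringDown i N)
  edge {M} (_ , _ , suc k , _ , k<n , refl) rewrite fOp-moveRight k k<n M =
    sym (trans (cong profile (bringDown-moveRight k k<n i M)) (profile-moveRight k k<n (bringDown i M)))

theorem2p37 : (n : ℕ) (λ′ : List ℕ) → IsPartition λ′ → length λ′ < n →
    (M M′ : Config n) → IsMLQ n λ′ M → IsMLQ n λ′ M′ →
    SameComponent n λ′ M M′ →
    typeOf (rhoN M) ≡ typeOf (rhoN M′) → typeOf M ≡ typeOf M′
theorem2p37 n λ′ _ _ M M′ q q′ c e = keys⇒typeOf M M′ (MLQ⇒Decreasing λ′ M q) (MLQ⇒Decreasing λ′ M′ q′)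
  (at-ext (keys M) (keys M′) (trans (length-keys M) (trans len (sym (length-keys M′)))) same)
  where
  len : length M ≡ length M′
  len = trans (sym (length-map ∣_∣ M)) (trans (cong length (trans q (sym q′))) (length-map ∣_∣ M′))
  -- A nonwrapping configuration has decreasing row sizes, so its type determines its keys.
  keysN : keys (collapse M) ≡ keys (collapse M′)
  keysN = typeOf⇒keys (collapse M) (collapse M′)
    (trans (length-↝ (↝-collapse M)) (trans len (sym (length-↝ (↝-collapse M′)))))
    (Nonwrapping⇒Decreasing _ (Nonwrapping-collapse M)) (Nonwrapping⇒Decreasing _ (Nonwrapping-collapse M′))
    (trans (cong typeOf (sym (rhoN-collapse M))) (trans e (cong typeOf (rhoN-collapse M′))))
  same : ∀ i → i < length (keys M) → at i (keys M) ≡ at i (keys M′)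
  same i p = begin
    at i (keys M)                          ≡⟨ key-formula i M i<M ⟩
    rebuild (profile (bringDown i M)) (keys (collapse M))     ≡⟨ cong₂ rebuild (profile-component λ′ i c) keysN ⟩
    rebuild (profile (bringDown i M′)) (keys (collapse M′))   ≡⟨ key-formula i M′ (subst (i <_) len i<M) ⟨
    at i (keys M′)                         ∎
    where
    open ≡-Reasoning
    i<M : i < length M
    i<M = subst (i <_) (length-keys M) p
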